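{- For integers $a,b\ge 1$ let $\mathrm{CC}_{a,b}$ be the cycle-chord graph and $X_{\mathrm{CC}_{a,b}}$ its chromatic symmetric function. Then \[ \sum_{a,b\ge1}X_{\mathrm{CC}_{a,b}}\,x^ay^b =\frac{xy}{(x-y)^2}\left[ \frac{x^2E''(x)E(y)+y^2E''(y)E(x)}{F(x)F(y)} -\frac{2xy}{x-y}\left( \frac{E'(x)}{F(x)}-\frac{E'(y)}{F(y)}\right)\right], \] where $E(z)=\sum_{n\ge0}e_nz^n$ and $F(z)=E(z)-zE'(z)$.
   Context: For a finite simple graph $G$, the chromatic symmetric function is $X_G=\sum_\kappa\prod_{v\in V(G)}x_{\kappa(v)}$, where $x_1,x_2,\dots$ are commuting indeterminates and the sum is over all proper colorings $\kappa\colon V(G)\to\{1,2,3,\dots\}$. Here $e_n=\sum_{1\le i_1<\dots<i_n}x_{i_1}\dotsm x_{i_n}$ are the elementary symmetric functions, with $e_0=1$; primes denote formal derivatives with respect to $z$. The identity is one of formal power series in the two further indeterminates $x,y$ with coefficients in the ring of symmetric functions (after clearing the powers of $x-y$ in the denominators). The cycle-chord graph $\mathrm{CC}_{a,b}$ ($a,b\ge1$) is obtained by identifying an edge of the cycle $C_{a+1}$ with an edge of the cycle $C_{b+1}$. Explicitly, it has $a+b$ vertices $v_0,v_1,\dots,v_{a+b-1}$, and its edges are those of the cycle $v_0v_1\dotsm v_{a+b-1}v_0$ together with $v_0v_a$. Multiple edges are regarded as single edges (they do not affect proper colorings); thus $\mathrm{CC}_{1,b}=C_{b+1}$ and $\mathrm{CC}_{a,1}=C_{a+1}$,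 where $C_2$ is a single edge on two vertices. -}

module Defs where

open import Algebra.Bundles.Raw using (RawRing)
import Algebra.Definitions.RawSemiring as RawSemiringDefinitions
open import Data.Fin.Base using (Fin; toℕ)
import Data.Fin.Properties as Fin
open import Data.Integer.Base as ℤ using (ℤ; +_)
open import Data.List.Base as List using (List; []; _∷_; length; upTo; filter; cartesianProductWith)
import Data.List.Properties as List
open import Data.Nat.Base as ℕ using (ℕ; zero; suc; _∸_; NonZero)
import Data.Nat.Properties as ℕ
open import Data.Product.Base using (_×_; _,_)
open import Data.Sum.Base using (_⊎_; inj₁; inj₂; swap)
open import Data.Vec.Base as Vec using (Vec; []; _∷_; head; lookup)
open import Data.Vec.Relation.Unary.Linked using (Linked; linked?)
open import Function.Base using (_∘_)
open import Level using (0ℓ)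
open import Relation.Binary.Core using (Rel)
open import Relation.Binary.Definitions using (Symmetric; Decidable)
open import Relation.Binary.PropositionalEquality.Core using (_≡_; refl; sym; trans; cong)
open import Relation.Nullary.Decidable using (Dec; _×-dec_; _⊎-dec_; _→-dec_; ¬?)
open import Relation.Nullary.Negation.Core using (¬_)
import Relation.Unary as Unary

------------------------------------------------------------------------
-- Formal power series in one indeterminate z over a ring R; a series is
-- its sequence of coefficients.

module PowerSeries {c ℓ} (R : RawRing c ℓ) where
  open RawRing R
  open RawSemiringDefinitions (RawRing.rawSemiring R) using (sum) renaming (_×_ to _·_)

  Series : Set c
  Series = ℕ → Carrier

  constant : Carrier → Series
  constant r zero    = r
  constant r (suc n) = 0#

  indeterminate : Series
  indeterminate 1 = 1#
  indeterminate _ = 0#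

  rawRing : RawRing c ℓ
  rawRing = record
    { Carrier = Series
    ; _≈_     = λ f g → ∀ n → f n ≈ g n
    ; _+_     = λ f g n → f n + g n
    ; _*_     = λ f g n → sum {suc n} λ i → f (toℕ i) * g (n ∸ toℕ i)
    ; -_      = λ f n → - f n
    ; 0#      = λ _ → 0#
    ; 1#      = constant 1#
    }

  infixl 6 _-_
  _-_ : Series → Series → Series
  (f - g) n = f n + (- g n)

  infixl 9 _′
  _′ : Series → Series
  (f ′) n = suc n · f (suc n)

  -- Coefficients g n , … , g 0 (in this order) of the inverse g of a
  -- series f with constant term 1, read off from f * g = 1:
  --   g (suc n) = - (f 1 * g n + f 2 * g (n - 1) + … + f (suc n) * g 0).
  inverseCoefficients : Series → ∀ n → Vec Carrier (suc n)
  inverseCoefficients f zero    = 1# ∷ []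
  inverseCoefficients f (suc n) =
    - sum (λ i → f (suc (toℕ i)) * lookup gs i) ∷ gs
    where gs = inverseCoefficients f n

  -- The multiplicative inverse; only meaningful when f 0 ≈ 1#.
  infixl 9 _⁻¹
  _⁻¹ : Series → Series
  (f ⁻¹) n = head (inverseCoefficients f n)

------------------------------------------------------------------------
-- Formal power series over ℤ in the commuting indeterminates x₁, x₂, …,
-- the ring that contains the symmetric functions.
--
-- The list of exponents α₁ ∷ … ∷ α_N ∷ [] stands for the monomial
-- x₁^α₁ ⋯ x_N^α_N, and a series is its function of coefficients.  Lists
-- that differ by trailing zeros stand for the same monomial; series whose
-- coefficients agree on such lists are closed under the operations below,
-- since all factorisations of a monomial involve only its own variables.

Monomial : Set
Monomial = List ℕ

-- The sum runs over all β with β + γ = α componentwise.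
convolve : (Monomial → ℤ) → (Monomial → ℤ) → Monomial → ℤ
convolve f g []      = f [] ℤ.* g []
convolve f g (a ∷ α) = sum {suc a} λ i →
  convolve (f ∘ (toℕ i ∷_)) (g ∘ (a ∸ toℕ i ∷_)) α
  where open RawSemiringDefinitions (RawRing.rawSemiring ℤ.+-*-rawRing) using (sum)

one : Monomial → ℤ
one []          = ℤ.1ℤ
one (zero  ∷ α) = one α
one (suc _ ∷ α) = ℤ.0ℤ

ℤ⟦x₁,x₂,…⟧ : RawRing 0ℓ 0ℓ
ℤ⟦x₁,x₂,…⟧ = record
  { Carrier = Monomial → ℤ
  ; _≈_     = λ f g → ∀ α → f α ≡ g α
  ; _+_     = λ f g α → f α ℤ.+ g α
  ; _*_     = convolve
  ; -_      = λ f α → ℤ.- f α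
  ; 0#      = λ _ → ℤ.0ℤ
  ; 1#      = one
  }

Λ : Set
Λ = RawRing.Carrier ℤ⟦x₁,x₂,…⟧

vectors : ∀ {A : Set} → List A → ∀ n → List (Vec A n)
vectors as zero    = [] ∷ []
vectors as (suc n) = cartesianProductWith _∷_ as (vectors as n)

-- The exponents of x₁ , … , x_N in the product of the x_κ(v), where the
-- number i ∈ ℕ stands for the index i + 1.
exponents : ∀ {n} → ℕ → Vec ℕ n → List ℕ
exponents N κ = List.map (λ i → Vec.count (i ℕ.≟_) κ) (upTo N)

-- The sum of the monomials ∏ᵥ x_κ(v) over all κ : Vec ℕ n satisfying P.
-- The coefficient at a monomial in x₁ , … , x_N is the number of those κ
-- whose product is that monomial; they take values among the first N
-- indices only.
∑-monomials : ∀ {n} {P : Unary.Pred (Vec ℕ n) 0ℓ} → Unary.Decidable P → Λ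
∑-monomials {n} P? α =
  + length (filter (λ κ → P? κ ×-dec List.≡-dec ℕ._≟_ (exponents N κ) α)
                   (vectors (upTo N) n))
  where N = length α

e : ℕ → Λ
e n = ∑-monomials {n} (linked? ℕ._<?_)

------------------------------------------------------------------------
-- Chromatic symmetric functions

record SimpleGraph : Set₁ where
  field
    order       : ℕ
    Adjacent    : Rel (Fin order) 0ℓ
    adjacent?   : Decidable Adjacent
    symmetric   : Symmetric Adjacent
    irreflexive : ∀ {v} → ¬ Adjacent v v

open SimpleGraph

Proper : (G : SimpleGraph) → Vec ℕ (order G) → Set
Proper G κ = ∀ u v → Adjacent G u v → ¬ lookup κ u ≡ lookup κ v

proper? : (G : SimpleGraph) → Unary.Decidable (Proper G)
proper? G κ = Fin.all? λ u → Fin.all? λ v →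
  adjacent? G u v →-dec ¬? (lookup κ u ℕ.≟ lookup κ v)

X : SimpleGraph → Λ
X G = ∑-monomials (proper? G)

module CycleChord (a b : ℕ) where

  -- The edges vᵢvᵢ₊₁, the edge closing the cycle, and the chord v₀vₐ.
  Edge : Rel (Fin (a ℕ.+ b)) 0ℓ
  Edge u v = toℕ v ≡ suc (toℕ u)
           ⊎ (suc (toℕ u) ≡ a ℕ.+ b × toℕ v ≡ 0)
           ⊎ (toℕ u ≡ 0 × toℕ v ≡ a)

  edge? : Decidable Edge
  edge? u v = (toℕ v ℕ.≟ suc (toℕ u))
    ⊎-dec ((suc (toℕ u) ℕ.≟ a ℕ.+ b) ×-dec (toℕ v ℕ.≟ 0))
    ⊎-dec ((toℕ u ℕ.≟ 0) ×-dec (toℕ v ℕ.≟ a))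

  noLoop : .{{NonZero a}} → .{{NonZero b}} → ∀ {v} → ¬ Edge v v
  noLoop (inj₁ v≡1+v) = ℕ.1+n≢n (sym v≡1+v)
  noLoop (inj₂ (inj₁ (1+v≡a+b , v≡0))) =
    ℕ.<⇒≢ (ℕ.+-mono-≤ (ℕ.>-nonZero⁻¹ a) (ℕ.>-nonZero⁻¹ b))
          (trans (cong suc (sym v≡0)) 1+v≡a+b)
  noLoop (inj₂ (inj₂ (v≡0 , v≡a))) =
    ℕ.≢-nonZero⁻¹ a (trans (sym v≡a) v≡0)

CC : ∀ a b → .{{NonZero a}} → .{{NonZero b}} → SimpleGraph
CC a b = record
  { order       = a ℕ.+ b
  ; Adjacent    = λ u v → Edge u v ⊎ Edge v u
  ; adjacent?   = λ u v → edge? u v ⊎-dec edge? v u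
  ; symmetric   = swap
  ; irreflexive = λ { (inj₁ vv) → noLoop vv ; (inj₂ vv) → noLoop vv }
  }
  where open CycleChord a b

------------------------------------------------------------------------
-- Series in z, and in x and y, over the ring above

open PowerSeries ℤ⟦x₁,x₂,…⟧ public using (_′; _⁻¹)
  renaming (Series to Λ⟦z⟧; rawRing to rawRing-z; indeterminate to z)

-- Series in x whose coefficients are series in y: for such a series f,
-- the coefficient at x^a y^b is f a b.
module XY = PowerSeries (PowerSeries.rawRing ℤ⟦x₁,x₂,…⟧)

Λ⟦x,y⟧ : Set
Λ⟦x,y⟧ = XY.Series

x y : Λ⟦x,y⟧
x = XY.indeterminate
y = XY.constant z

-- f ⟨x⟩ and f ⟨y⟩ are the results of substituting x and y for z in f.
infixl 9 _⟨x⟩ _⟨y⟩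
_⟨x⟩ _⟨y⟩ : Λ⟦z⟧ → Λ⟦x,y⟧
f ⟨x⟩ = λ a → PowerSeries.constant ℤ⟦x₁,x₂,…⟧ (f a)
f ⟨y⟩ = XY.constant f

open XY public using (_-_)
open RawRing XY.rawRing public using (_≈_; _+_; _*_)
open RawSemiringDefinitions (RawRing.rawSemiring XY.rawRing) public
  using (_^_) renaming (_×_ to _·_)

E F : Λ⟦z⟧
E = e
F = E -ᶻ (z *ᶻ E ′)
  where
  open PowerSeries ℤ⟦x₁,x₂,…⟧ using () renaming (_-_ to _-ᶻ_)
  open RawRing rawRing-z using () renaming (_*_ to _*ᶻ_)

-- The sum of X (CC a b) x^a y^b over all a, b ≥ 1.
∑X-CC : Λ⟦x,y⟧
∑X-CC a@(suc _) b@(suc _) = X (CC a b)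
∑X-CC _         _         = RawRing.0# ℤ⟦x₁,x₂,…⟧

{-# OPTIONS --safe #-}
module Submission where

-- A coefficient at a monomial in x₁ , … , x_N only involves the first N
-- colors.  With finitely many colors, a proper coloring of CC a b consists of
-- the distinct colors i and j of v₀ and vₐ and of two walks without
-- stationary steps, from i to j and back, on the set of colors.  By the
-- resolvent of the transfer matrix, the walks from i to j ≠ i have the
-- generating function E dᵢ dⱼ / F with dᵢ = 1 / (1 + z xᵢ).  So the sum over
-- CC a b is x y E(x) E(y) / (F(x) F(y)) times the sum over i ≠ j of wᵢ wⱼ,
-- where wᵢ = xᵢ / ((1 + x xᵢ) (1 + y xᵢ)).  By partial fractions, with
-- uᵢ = xᵢ dᵢ, this sum reduces to ∑ uᵢ and ∑ uᵢ² at x and at y, and these are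
-- given by E ′ and E ′ ′, since E = ∏ (1 + z xᵢ).

-- With infinitely many indeterminates, neither the product formula for `E` nor the sum over pairs
-- of colors is a finite expression in `Λ`. For a monomial with N exponents, a coarser equality
-- `_≈[ N ]_` is therefore used: under it the same operations still form a commutative ring, and all
-- sums and products over colors are finite.
--
-- Nothing is ever divided by x - y. Partial fractions are stated after multiplication by x - y, and
-- the exponent 3 is their cost: the sum over i ≠ j is (∑ wᵢ)² - ∑ wᵢ², where each wᵢ takes one
-- factor, and the cross terms of wᵢ², products of uᵢ at x with uᵢ at y, take a third one.
--
-- The second derivative enters because E ′ ′ / E is the sum of uᵢ uⱼ over i ≠ j, the same
-- combination (∑ uᵢ)² - ∑ uᵢ². The series F enters because F = E (1 - z ∑ uᵢ), and 1 - z ∑ uᵢ is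
-- the denominator produced by the rank one perturbation.

open import Algebra.Bundles using (CommutativeRing)
open import Algebra.Bundles.Raw using (RawRing)
import Algebra.Definitions.RawSemiring as RawSemiringDefinitions
import Algebra.Morphism.RingMonomorphism as RingMonomorphism
open import Algebra.Morphism.Structures using (module RingMorphisms)
import Algebra.Solver.Ring as RingSolver
open import Algebra.Solver.Ring.AlmostCommutativeRing
  using (fromCommutativeRing; _-Raw-AlmostCommutative⟶_)
open import Algebra.Structures using (IsCommutativeRing)
open import Data.Bool.Base using (Bool; true; false; not; if_then_else_; _∧_)
open import Data.Fin.Base using (Fin; zero; suc; toℕ; fromℕ<)
import Data.Fin.Properties as Fin
open import Data.Integer.Base as ℤ using (ℤ; +_)
import Data.Integer.Properties as ℤ
open import Data.List.Base as List
  using (List; []; _∷_; length; upTo; applyUpTo; filter; cartesianProductWith; _++_)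
import Data.List.Properties as List
open import Data.Maybe.Base using (Maybe; just; nothing)
open import Data.Nat.Base as ℕ
  using (ℕ; zero; suc; _∸_; _≡ᵇ_; _<ᵇ_; _≤ᵇ_; _≤_; _<_; z≤n; s<s; z<s)
import Data.Nat.Properties as ℕ
open import Data.Product.Base using (_×_; _,_; proj₁; proj₂)
open import Data.Sum.Base using (inj₁; inj₂)
open import Data.Unit.Base using (⊤; tt)
open import Data.Vec.Base as Vec using (Vec; []; _∷_; lookup) renaming (_++_ to _++ᵛ_)
open import Data.Vec.Relation.Unary.All using (All; []; _∷_)
open import Data.Vec.Relation.Unary.Linked using (Linked; linked?; [-]; []; _∷_)
open import Defs hiding (_′; _⁻¹; _+_; _*_; _-_; _≈_; _^_; _·_; z)
open import Function.Base using (_∘_; id)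
open import Function.Bundles using (_⇔_; mk⇔; Equivalence)
open import Level using (0ℓ)
open import Relation.Binary.Core using (Rel)
open import Relation.Binary.PropositionalEquality as ≡ using (_≡_; _≢_)
open import Relation.Nullary using (Dec; yes; no; does; contradiction)
open import Relation.Nullary.Decidable using (_×-dec_; ¬?; does-⇔)
import Relation.Unary as Unary

open RingMorphisms using (IsRingHomomorphism; IsRingMonomorphism; module IsRingHomomorphism)
open RawSemiringDefinitions (RawRing.rawSemiring ℤ⟦x₁,x₂,…⟧) using () renaming (sum to sumΛ)
open RawSemiringDefinitions (RawRing.rawSemiring ℤ.+-*-rawRing) using () renaming (sum to sumℤ)

-- A ring solver with integer coefficients over any commutative ring

-- The coefficient (m , n) stands for the integer m - n.
module IntegerSolver {c ℓ} (R : CommutativeRing c ℓ) where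
  open CommutativeRing R
  open import Algebra.Properties.Ring ring
  open import Algebra.Properties.AbelianGroup +-abelianGroup using (⁻¹-∙-comm)
  open import Algebra.Properties.CommutativeSemigroup +-commutativeSemigroup using (interchange)
  open import Algebra.Properties.Semiring.Mult semiring
    using (×-homo-+; ×1-homo-*; ×-congˡ) renaming (_×_ to _·_)
  open import Relation.Binary.Reasoning.Setoid setoid

  differences : RawRing 0ℓ 0ℓ
  differences = record
    { Carrier = ℕ × ℕ
    ; _≈_     = _≡_
    ; _+_     = λ { (a , b) (c , d) → a ℕ.+ c , b ℕ.+ d }
    ; _*_     = λ { (a , b) (c , d) → a ℕ.* c ℕ.+ b ℕ.* d , a ℕ.* d ℕ.+ b ℕ.* c }
    ; -_      = λ { (a , b) → b , a }
    ; 0#      = 0 , 0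
    ; 1#      = 1 , 0
    }

  -- The first two clauses make con (0 , 0) and con (1 , 0) denote 0# and 1#
  -- on the nose.
  value : ℕ × ℕ → Carrier
  value (0 , 0)     = 0#
  value (1 , 0)     = 1#
  value (m , n) = m · 1# - n · 1#

  value-≈ : ∀ m n → value (m , n) ≈ m · 1# - n · 1#
  value-≈ 0 0 = sym (-‿inverseʳ 0#)
  value-≈ 1 0 = sym (trans (+-cong (+-identityʳ 1#) -0#≈0#) (+-identityʳ 1#))
  value-≈ 0 (suc n) = refl
  value-≈ 1 (suc n) = refl
  value-≈ (suc (suc m)) n = refl

  [a-b]+[c-d] : ∀ a b c d → (a - b) + (c - d) ≈ (a + c) - (b + d)
  [a-b]+[c-d] a b c d = trans (interchange a (- b) c (- d)) (+-congˡ (⁻¹-∙-comm b d))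

  [a-b]*[c-d] : ∀ a b c d → (a - b) * (c - d) ≈ (a * c + b * d) - (a * d + b * c)
  [a-b]*[c-d] a b c d = begin
    (a - b) * (c - d)                     ≈⟨ distribʳ (c - d) a (- b) ⟩
    a * (c - d) + - b * (c - d)           ≈⟨ +-cong (distribˡ a c (- d)) (distribˡ (- b) c (- d)) ⟩
    (a * c + a * - d) + (- b * c + - b * - d)
      ≈⟨ +-cong (+-congˡ (sym (-‿distribʳ-* a d)))
                (trans (+-comm _ _) (+-cong (trans (sym (-‿distribˡ-* b (- d)))
                   (trans (-‿cong (sym (-‿distribʳ-* b d))) (-‿involutive _))) (sym (-‿distribˡ-* b c)))) ⟩
    (a * c - a * d) + (b * d - b * c)     ≈⟨ [a-b]+[c-d] _ _ _ _ ⟩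
    (a * c + b * d) - (a * d + b * c)     ∎

  -[a-b] : ∀ a b → - (a - b) ≈ b - a
  -[a-b] a b = trans (sym (⁻¹-∙-comm a (- b))) (trans (+-comm _ _) (+-congʳ (-‿involutive b)))

  value-homomorphism : differences -Raw-AlmostCommutative⟶ fromCommutativeRing R
  value-homomorphism = record
    { ⟦_⟧    = value
    ; +-homo = λ { (a , b) (c , d) → begin
        value (a ℕ.+ c , b ℕ.+ d)                 ≈⟨ value-≈ (a ℕ.+ c) _ ⟩
        (a ℕ.+ c) · 1# - (b ℕ.+ d) · 1#
          ≈⟨ +-cong (×-homo-+ 1# a c) (-‿cong (×-homo-+ 1# b d)) ⟩
        (a · 1# + c · 1#) - (b · 1# + d · 1#)      ≈⟨ [a-b]+[c-d] _ _ _ _ ⟨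
        (a · 1# - b · 1#) + (c · 1# - d · 1#)      ≈⟨ +-cong (value-≈ a b) (value-≈ c d) ⟨
        value (a , b) + value (c , d)              ∎ }
    ; *-homo = λ { (a , b) (c , d) → begin
        value (a ℕ.* c ℕ.+ b ℕ.* d , a ℕ.* d ℕ.+ b ℕ.* c)  ≈⟨ value-≈ (a ℕ.* c ℕ.+ b ℕ.* d) _ ⟩
        (a ℕ.* c ℕ.+ b ℕ.* d) · 1# - (a ℕ.* d ℕ.+ b ℕ.* c) · 1#
          ≈⟨ +-cong (homo a c b d) (-‿cong (homo a d b c)) ⟩
        (a · 1# * (c · 1#) + b · 1# * (d · 1#)) - (a · 1# * (d · 1#) + b · 1# * (c · 1#))
          ≈⟨ [a-b]*[c-d] _ _ _ _ ⟨
        (a · 1# - b · 1#) * (c · 1# - d · 1#)      ≈⟨ *-cong (value-≈ a b) (value-≈ c d) ⟨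
        value (a , b) * value (c , d)              ∎ }
    ; -‿homo = λ { (a , b) → begin
        value (b , a)          ≈⟨ value-≈ b a ⟩
        b · 1# - a · 1#        ≈⟨ -[a-b] _ _ ⟨
        - (a · 1# - b · 1#)    ≈⟨ -‿cong (value-≈ a b) ⟨
        - value (a , b)        ∎ }
    ; 0-homo = refl
    ; 1-homo = refl
    }
    where
    homo : ∀ a c b d → (a ℕ.* c ℕ.+ b ℕ.* d) · 1# ≈ a · 1# * (c · 1#) + b · 1# * (d · 1#)
    homo a c b d = trans (×-homo-+ 1# (a ℕ.* c) (b ℕ.* d)) (+-cong (×1-homo-* a c) (×1-homo-* b d))

  -- Pairs are not kept in reduced form, so m - n is compared by adding crosswise. Distinct integers
  -- may have equal values in the ring; then nothing is claimed.
  value≟ : ∀ p q → Maybe (value p ≈ value q)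
  value≟ (a , b) (c , d) with a ℕ.+ d ℕ.≟ c ℕ.+ b
  ... | no  _       = nothing
  ... | yes a+d≡c+b = just (begin
    value (a , b)                              ≈⟨ value-≈ a b ⟩
    a · 1# - b · 1#                            ≈⟨ shift a b d ⟩
    (a ℕ.+ d) · 1# - (b ℕ.+ d) · 1#            ≈⟨ +-cong (×-congˡ a+d≡c+b) (-‿cong (×-congˡ (ℕ.+-comm b d))) ⟩
    (c ℕ.+ b) · 1# - (d ℕ.+ b) · 1#            ≈⟨ shift c d b ⟨
    c · 1# - d · 1#                            ≈⟨ value-≈ c d ⟨
    value (c , d)                              ∎)
    where
    shift : ∀ a b d → a · 1# - b · 1# ≈ (a ℕ.+ d) · 1# - (b ℕ.+ d) · 1#
    shift a b d = begin
      a · 1# - b · 1#                        ≈⟨ +-identityʳ _ ⟨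
      (a · 1# - b · 1#) + 0#                 ≈⟨ +-congˡ (-‿inverseʳ (d · 1#)) ⟨
      (a · 1# - b · 1#) + (d · 1# - d · 1#)  ≈⟨ [a-b]+[c-d] _ _ _ _ ⟩
      (a · 1# + d · 1#) - (b · 1# + d · 1#)
        ≈⟨ +-cong (×-homo-+ 1# a d) (-‿cong (×-homo-+ 1# b d)) ⟨
      (a ℕ.+ d) · 1# - (b ℕ.+ d) · 1#        ∎

  open RingSolver differences (fromCommutativeRing R) value-homomorphism value≟ public
    using (solve; _:=_; _:+_; _:*_; _:-_; :-_; con)

record HomomorphismLaws {a b ℓ₁ ℓ₂} (R : RawRing a ℓ₁) (S : RawRing b ℓ₂)
                        (⟦_⟧ : RawRing.Carrier R → RawRing.Carrier S) : Set (a Level.⊔ ℓ₁ Level.⊔ ℓ₂) where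
  private
    module R = RawRing R
    module S = RawRing S
  field
    cong   : ∀ {p q} → p R.≈ q → ⟦ p ⟧ S.≈ ⟦ q ⟧
    +-homo : ∀ p q → ⟦ p R.+ q ⟧ S.≈ ⟦ p ⟧ S.+ ⟦ q ⟧
    *-homo : ∀ p q → ⟦ p R.* q ⟧ S.≈ ⟦ p ⟧ S.* ⟦ q ⟧
    -‿homo : ∀ p → ⟦ R.- p ⟧ S.≈ S.- ⟦ p ⟧
    0-homo : ⟦ R.0# ⟧ S.≈ S.0#
    1-homo : ⟦ R.1# ⟧ S.≈ S.1#

isRingHomomorphism : ∀ {a b ℓ₁ ℓ₂} {R : RawRing a ℓ₁} {S : RawRing b ℓ₂} {⟦_⟧} →
  HomomorphismLaws R S ⟦_⟧ → IsRingHomomorphism R S ⟦_⟧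
isRingHomomorphism laws = record
  { isSemiringHomomorphism = record
    { isNearSemiringHomomorphism = record
      { +-isMonoidHomomorphism = record
        { isMagmaHomomorphism = record
          { isRelHomomorphism = record { cong = L.cong } ; homo = L.+-homo }
        ; ε-homo = L.0-homo }
      ; *-homo = L.*-homo }
    ; 1#-homo = L.1-homo }
  ; -‿homo = L.-‿homo }
  where module L = HomomorphismLaws laws

-- Formal power series in one indeterminate

-- The equality is a separate parameter: the operations of power series
-- take a raw ring together with its equality, but all computations take
-- place modulo a coarser one.
IsCommutativeRingUnder : ∀ {c ℓ₀ ℓ} (R : RawRing c ℓ₀) → Rel (RawRing.Carrier R) ℓ → Set (c Level.⊔ ℓ)
IsCommutativeRingUnder R _~_ = IsCommutativeRing _~_ _+_ _*_ -_ 0# 1#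
  where open RawRing R

module SeriesProperties {c ℓ₀ ℓ} (R : RawRing c ℓ₀) (_~_ : Rel (RawRing.Carrier R) ℓ)
  (isCommutativeRing : IsCommutativeRingUnder R _~_) where

  coefficientRing : CommutativeRing c ℓ
  coefficientRing = record { isCommutativeRing = isCommutativeRing }

  open CommutativeRing coefficientRing hiding (zero)
  open import Algebra.Properties.Ring ring using (-0#≈0#)
  open import Algebra.Properties.CommutativeSemigroup +-commutativeSemigroup using (interchange)
  open import Relation.Binary.Reasoning.Setoid setoid
  import Algebra.Definitions.RawSemiring (RawRing.rawSemiring R) as R using (_×_; sum)
  open PowerSeries R public hiding (_-_) renaming (rawRing to rawRingˢ)
  open RawRing rawRingˢ public using ()
    renaming (_+_ to infixl 6 _+ˢ_; _*_ to infixl 7 _*ˢ_; -_ to -ˢ_; 0# to 0ˢ; 1# to 1ˢ)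

  infix 4 _≈ˢ_
  _≈ˢ_ : Rel Series ℓ
  f ≈ˢ g = ∀ n → f n ≈ g n

  tail : Series → Series
  tail f n = f (suc n)

  -- By definition, (f *ˢ g) (suc n) is f 0 * g (suc n) + (tail f *ˢ g) n; all
  -- laws of the product follow from this recursion.
  *ˢ-cong : ∀ {f f₁ g g₁} → f ≈ˢ f₁ → g ≈ˢ g₁ → f *ˢ g ≈ˢ f₁ *ˢ g₁
  *ˢ-cong p q zero    = +-congʳ (*-cong (p 0) (q 0))
  *ˢ-cong p q (suc n) = +-cong (*-cong (p 0) (q (suc n))) (*ˢ-cong (λ i → p (suc i)) q n)

  *ˢ-zeroˡ : ∀ f → 0ˢ *ˢ f ≈ˢ 0ˢ
  *ˢ-zeroˡ f zero    = trans (+-identityʳ _) (zeroˡ _)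
  *ˢ-zeroˡ f (suc n) = trans (+-cong (zeroˡ _) (*ˢ-zeroˡ f n)) (+-identityʳ 0#)

  constant-* : ∀ r f n → (constant r *ˢ f) n ≈ r * f n
  constant-* r f zero    = +-identityʳ _
  constant-* r f (suc n) = trans (+-congˡ (*ˢ-zeroˡ f n)) (+-identityʳ _)

  *ˢ-identityˡ : ∀ f → 1ˢ *ˢ f ≈ˢ f
  *ˢ-identityˡ f n = trans (constant-* 1# f n) (*-identityˡ (f n))

  -- The mirror image of the defining recursion, peeling off the right factor instead of the left
  -- one; commutativity follows by comparing the two.
  tail-*ʳ : ∀ f g n → (f *ˢ g) (suc n) ≈ (f *ˢ tail g) n + f (suc n) * g 0
  tail-*ʳ f g zero    = trans (+-congˡ (+-identityʳ _)) (+-congʳ (sym (+-identityʳ _)))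
  tail-*ʳ f g (suc n) = trans (+-congˡ (tail-*ʳ (tail f) g n)) (sym (+-assoc _ _ _))

  *ˢ-comm : ∀ f g → f *ˢ g ≈ˢ g *ˢ f
  *ˢ-comm f g zero    = +-congʳ (*-comm (f 0) (g 0))
  *ˢ-comm f g (suc n) = begin
    f 0 * g (suc n) + (tail f *ˢ g) n   ≈⟨ +-cong (*-comm _ _) (*ˢ-comm (tail f) g n) ⟩
    g (suc n) * f 0 + (g *ˢ tail f) n   ≈⟨ +-comm _ _ ⟩
    (g *ˢ tail f) n + g (suc n) * f 0   ≈⟨ tail-*ʳ g f n ⟨
    (g *ˢ f) (suc n)                    ∎

  *ˢ-distribʳ : ∀ h f g → (f +ˢ g) *ˢ h ≈ˢ (f *ˢ h) +ˢ (g *ˢ h)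
  *ˢ-distribʳ h f g zero    = trans (+-identityʳ _) (trans (distribʳ (h 0) (f 0) (g 0))
    (sym (+-cong (+-identityʳ _) (+-identityʳ _))))
  *ˢ-distribʳ h f g (suc n) =
    trans (+-cong (distribʳ (h (suc n)) (f 0) (g 0)) (*ˢ-distribʳ h (tail f) (tail g) n))
          (interchange _ _ _ _)

  *ˢ-scale : ∀ r f g n → ((λ i → r * f i) *ˢ g) n ≈ r * (f *ˢ g) n
  *ˢ-scale r f g zero    = trans (+-identityʳ _) (trans (*-assoc r (f 0) (g 0)) (*-congˡ (sym (+-identityʳ _))))
  *ˢ-scale r f g (suc n) =
    trans (+-cong (*-assoc r (f 0) (g (suc n))) (*ˢ-scale r (tail f) g n)) (sym (distribˡ r _ _))

  *ˢ-assoc : ∀ f g h → (f *ˢ g) *ˢ h ≈ˢ f *ˢ (g *ˢ h)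
  *ˢ-assoc f g h zero    = +-congʳ (begin
    (f 0 * g 0 + 0#) * h 0   ≈⟨ *-congʳ (+-identityʳ _) ⟩
    f 0 * g 0 * h 0          ≈⟨ *-assoc _ _ _ ⟩
    f 0 * (g 0 * h 0)        ≈⟨ *-congˡ (+-identityʳ _) ⟨
    f 0 * (g 0 * h 0 + 0#)   ∎)
  *ˢ-assoc f g h (suc n) = begin
    (f 0 * g 0 + 0#) * h (suc n) + (((λ i → f 0 * g (suc i)) +ˢ (tail f *ˢ g)) *ˢ h) n
      ≈⟨ +-cong (trans (*-congʳ (+-identityʳ _)) (*-assoc _ _ _))
                (trans (*ˢ-distribʳ h (λ i → f 0 * g (suc i)) (tail f *ˢ g) n)
                  (+-cong (*ˢ-scale (f 0) (tail g) h n) (*ˢ-assoc (tail f) g h n))) ⟩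
    f 0 * (g 0 * h (suc n)) + (f 0 * (tail g *ˢ h) n + (tail f *ˢ (g *ˢ h)) n)
      ≈⟨ +-assoc _ _ _ ⟨
    f 0 * (g 0 * h (suc n)) + f 0 * (tail g *ˢ h) n + (tail f *ˢ (g *ˢ h)) n
      ≈⟨ +-congʳ (distribˡ (f 0) _ _) ⟨
    (f *ˢ (g *ˢ h)) (suc n)  ∎

  isCommutativeRingˢ : IsCommutativeRing _≈ˢ_ _+ˢ_ _*ˢ_ -ˢ_ 0ˢ 1ˢ
  isCommutativeRingˢ = record
    { isRing = record
      { +-isAbelianGroup = record
        { isGroup = record
          { isMonoid = record
            { isSemigroup = record
              { isMagma = record
                { isEquivalence = record
                  { refl  = λ n → refl
                  ; sym   = λ p n → sym (p n)
                  ; trans = λ p q n → trans (p n) (q n)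
                  }
                ; ∙-cong = λ p q n → +-cong (p n) (q n)
                }
              ; assoc = λ f g h n → +-assoc (f n) (g n) (h n)
              }
            ; identity = (λ f n → +-identityˡ (f n)) , (λ f n → +-identityʳ (f n))
            }
          ; inverse = (λ f n → -‿inverseˡ (f n)) , (λ f n → -‿inverseʳ (f n))
          ; ⁻¹-cong = λ p n → -‿cong (p n)
          }
        ; comm = λ f g n → +-comm (f n) (g n)
        }
      ; *-cong = *ˢ-cong
      ; *-assoc = *ˢ-assoc
      ; *-identity = *ˢ-identityˡ , λ f n → trans (*ˢ-comm f 1ˢ n) (*ˢ-identityˡ f n)
      ; distrib = (λ h f g n → trans (*ˢ-comm h (f +ˢ g) n) (trans (*ˢ-distribʳ h f g n)
                      (+-cong (*ˢ-comm f h n) (*ˢ-comm g h n))))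
                , *ˢ-distribʳ
      }
    ; *-comm = *ˢ-comm
    }

  seriesRing : CommutativeRing c ℓ
  seriesRing = record { isCommutativeRing = isCommutativeRingˢ }

  constant-cong : ∀ {r s} → r ≈ s → constant r ≈ˢ constant s
  constant-cong r≈s zero    = r≈s
  constant-cong r≈s (suc n) = refl

  constant-isRingHomomorphism :
    IsRingHomomorphism (CommutativeRing.rawRing coefficientRing) (CommutativeRing.rawRing seriesRing) constant
  constant-isRingHomomorphism = isRingHomomorphism record
    { cong   = constant-cong
    ; +-homo = λ { r s zero → refl ; r s (suc n) → sym (+-identityʳ 0#) }
    ; *-homo = λ { r s zero → sym (+-identityʳ _)
                 ; r s (suc n) → sym (trans (constant-* r (constant s) (suc n)) (zeroʳ r)) }
    ; -‿homo = λ { r zero → refl ; r (suc n) → sym -0#≈0# }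
    ; 0-homo = λ { zero → refl ; (suc n) → refl }
    ; 1-homo = λ n → refl
    }

  indeterminate-*₀ : ∀ f → (indeterminate *ˢ f) 0 ≈ 0#
  indeterminate-*₀ f = trans (+-identityʳ _) (zeroˡ (f 0))

  indeterminate-* : ∀ f n → (indeterminate *ˢ f) (suc n) ≈ f n
  indeterminate-* f n = begin
    0# * f (suc n) + (tail indeterminate *ˢ f) n   ≈⟨ +-cong (zeroˡ _) (*ˢ-cong {g = f} tail-z (λ _ → refl) n) ⟩
    0# + (1ˢ *ˢ f) n                               ≈⟨ +-identityˡ _ ⟩
    (1ˢ *ˢ f) n                                    ≈⟨ *ˢ-identityˡ f n ⟩
    f n                                            ∎
    where
    tail-z : tail indeterminate ≈ˢ 1ˢ
    tail-z zero    = refl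
    tail-z (suc n) = refl

  linear-*₀ : ∀ r f → ((1ˢ +ˢ (indeterminate *ˢ constant r)) *ˢ f) 0 ≈ f 0
  linear-*₀ r f = begin
    (1# + (indeterminate *ˢ constant r) 0) * f 0 + 0#  ≈⟨ +-identityʳ _ ⟩
    (1# + (indeterminate *ˢ constant r) 0) * f 0
      ≈⟨ *-congʳ (trans (+-congˡ (indeterminate-*₀ (constant r))) (+-identityʳ 1#)) ⟩
    1# * f 0                                           ≈⟨ *-identityˡ _ ⟩
    f 0                                                ∎

  linear-* : ∀ r f n → ((1ˢ +ˢ (indeterminate *ˢ constant r)) *ˢ f) (suc n) ≈ f (suc n) + r * f n
  linear-* r f n = begin
    ((1ˢ +ˢ (indeterminate *ˢ constant r)) *ˢ f) (suc n)
      ≈⟨ *ˢ-distribʳ f 1ˢ (indeterminate *ˢ constant r) (suc n) ⟩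
    (1ˢ *ˢ f) (suc n) + ((indeterminate *ˢ constant r) *ˢ f) (suc n)
      ≈⟨ +-cong (*ˢ-identityˡ f (suc n)) (*ˢ-assoc indeterminate (constant r) f (suc n)) ⟩
    f (suc n) + (indeterminate *ˢ (constant r *ˢ f)) (suc n)
      ≈⟨ +-congˡ (trans (indeterminate-* (constant r *ˢ f) n) (constant-* r f n)) ⟩
    f (suc n) + r * f n ∎

  sum-cong : ∀ {n} {s t : Fin n → Carrier} → (∀ i → s i ≈ t i) → R.sum s ≈ R.sum t
  sum-cong {zero}  p = refl
  sum-cong {suc n} p = +-cong (p zero) (sum-cong (λ i → p (suc i)))

  lookup-inverseCoefficients : ∀ f n i → lookup (inverseCoefficients f n) i ≡ (f ⁻¹) (n ∸ toℕ i)
  lookup-inverseCoefficients f zero    zero    = ≡.refl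
  lookup-inverseCoefficients f (suc n) zero    = ≡.refl
  lookup-inverseCoefficients f (suc n) (suc i) = lookup-inverseCoefficients f n i

  -- The recursion for the inverse is this equation solved for its newest coefficient, which the
  -- constant term 1 allows.
  ⁻¹-inverseʳ : ∀ f → f 0 ≈ 1# → f *ˢ f ⁻¹ ≈ˢ 1ˢ
  ⁻¹-inverseʳ f f₀≈1 zero    = trans (+-identityʳ _) (trans (*-identityʳ _) f₀≈1)
  ⁻¹-inverseʳ f f₀≈1 (suc n) = begin
    f 0 * (f ⁻¹) (suc n) + (tail f *ˢ f ⁻¹) n   ≈⟨ +-congʳ (trans (*-congʳ f₀≈1) (*-identityˡ _)) ⟩
    (f ⁻¹) (suc n) + (tail f *ˢ f ⁻¹) n
      ≈⟨ +-congʳ (-‿cong (sum-cong λ i → *-congˡ {f (suc (toℕ i))} (reflexive (lookup-inverseCoefficients f n i)))) ⟩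
    - (tail f *ˢ f ⁻¹) n + (tail f *ˢ f ⁻¹) n   ≈⟨ -‿inverseˡ _ ⟩
    0#                                          ∎

  ·-cong : ∀ n {r s} → r ≈ s → n R.× r ≈ n R.× s
  ·-cong zero    p = refl
  ·-cong (suc n) p = +-cong p (·-cong n p)

  ·-zero : ∀ n → n R.× 0# ≈ 0#
  ·-zero zero    = refl
  ·-zero (suc n) = trans (+-identityˡ _) (·-zero n)

  ·-distrib-+ : ∀ n r s → n R.× (r + s) ≈ n R.× r + n R.× s
  ·-distrib-+ zero    r s = sym (+-identityʳ 0#)
  ·-distrib-+ (suc n) r s = trans (+-congˡ (·-distrib-+ n r s)) (interchange _ _ _ _)

  ·-* : ∀ n r s → n R.× (r * s) ≈ r * (n R.× s)
  ·-* zero    r s = sym (zeroʳ r)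
  ·-* (suc n) r s = trans (+-congˡ (·-* n r s)) (sym (distribˡ r _ _))

  ′-cong : ∀ {f g} → f ≈ˢ g → f ′ ≈ˢ g ′
  ′-cong p n = ·-cong (suc n) (p (suc n))

  ′-+ : ∀ f g → (f +ˢ g) ′ ≈ˢ f ′ +ˢ g ′
  ′-+ f g n = ·-distrib-+ (suc n) _ _

  ′-constant-* : ∀ r f → (constant r *ˢ f) ′ ≈ˢ constant r *ˢ f ′
  ′-constant-* r f n = begin
    suc n R.× (constant r *ˢ f) (suc n)  ≈⟨ ·-cong (suc n) (constant-* r f (suc n)) ⟩
    suc n R.× (r * f (suc n))            ≈⟨ ·-* (suc n) r _ ⟩
    r * (f ′) n                          ≈⟨ constant-* r (f ′) n ⟨
    (constant r *ˢ f ′) n                ∎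

  -- The product rule is only needed for linear factors, since `E` is built from them one at a time.
  ′-linear-* : ∀ r f → ((1ˢ +ˢ (indeterminate *ˢ constant r)) *ˢ f) ′
    ≈ˢ ((1ˢ +ˢ (indeterminate *ˢ constant r)) *ˢ f ′) +ˢ (constant r *ˢ f)
  ′-linear-* r f zero = begin
    1 R.× (l *ˢ f) 1                   ≈⟨ ·-cong 1 (linear-* r f 0) ⟩
    1 R.× (f 1 + r * f 0)              ≈⟨ ·-distrib-+ 1 _ _ ⟩
    (f ′) 0 + 1 R.× (r * f 0)          ≈⟨ +-cong {(f ′) 0} (sym (linear-*₀ r (f ′))) (trans (+-identityʳ _) (sym (constant-* r f 0))) ⟩
    (l *ˢ f ′) 0 + (constant r *ˢ f) 0 ∎
    where l = 1ˢ +ˢ (indeterminate *ˢ constant r)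
  ′-linear-* r f (suc n) = begin
    suc (suc n) R.× (l *ˢ f) (suc (suc n))             ≈⟨ ·-cong (suc (suc n)) (linear-* r f (suc n)) ⟩
    suc (suc n) R.× (f (suc (suc n)) + r * f (suc n))  ≈⟨ ·-distrib-+ (suc (suc n)) _ _ ⟩
    (f ′) (suc n) + (r * f (suc n) + suc n R.× (r * f (suc n)))
      -- Of the n + 2 copies of `r * f (suc n)`, one is the derivative of the linear factor times
      -- `f`; the other n + 1 form `r * (f ′) n`.
      ≈⟨ +-congˡ (trans (+-comm _ _) (+-congʳ (·-* (suc n) r _))) ⟩
    (f ′) (suc n) + (r * (f ′) n + r * f (suc n))      ≈⟨ +-assoc _ _ _ ⟨
    (f ′) (suc n) + r * (f ′) n + r * f (suc n)
      ≈⟨ +-cong (sym (linear-* r (f ′) n)) (sym (constant-* r f (suc n))) ⟩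
    (l *ˢ f ′) (suc n) + (constant r *ˢ f) (suc n)     ∎
    where l = 1ˢ +ˢ (indeterminate *ˢ constant r)

-- Finite sums and indicators

module Sums {c ℓ} (R : CommutativeRing c ℓ) where
  open CommutativeRing R hiding (zero)
  open import Algebra.Properties.Semiring.Sum semiring public
    using (sum; sum-cong-≋; sum-replicate-zero; ∑-distrib-+; ∑-comm; *-distribˡ-sum; *-distribʳ-sum)
  open import Algebra.Properties.Ring ring using (-1*x≈-x)
  open IntegerSolver R
  open import Relation.Binary.Reasoning.Setoid setoid

  indicator : Bool → Carrier
  indicator b = if b then 1# else 0#

  indicator-∧ : ∀ b c → indicator (b ∧ c) ≈ indicator b * indicator c
  indicator-∧ true  c = sym (*-identityˡ _)
  indicator-∧ false c = sym (zeroˡ _)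

  indicator-not : ∀ b → indicator (not b) ≈ 1# - indicator b
  indicator-not true  = sym (-‿inverseʳ 1#)
  indicator-not false = solve 0 (con (1 , 0) := con (1 , 0) :- con (0 , 0)) refl

  sum-zero : ∀ {n} {s : Fin n → Carrier} → (∀ i → s i ≈ 0#) → sum s ≈ 0#
  sum-zero {n} s≈0 = trans (sum-cong-≋ s≈0) (sum-replicate-zero n)

  sum-neg : ∀ {n} (s : Fin n → Carrier) → sum (λ i → - s i) ≈ - sum s
  sum-neg s = begin
    sum (λ i → - s i)       ≈⟨ sum-cong-≋ (λ i → -1*x≈-x (s i)) ⟨
    sum (λ i → - 1# * s i)  ≈⟨ *-distribˡ-sum (- 1#) s ⟨
    - 1# * sum s            ≈⟨ -1*x≈-x _ ⟩
    - sum s                 ∎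

  sum-δ : ∀ {n} (i : Fin n) s → sum (λ j → indicator (toℕ i ≡ᵇ toℕ j) * s j) ≈ s i
  sum-δ zero    s = trans (+-cong (*-identityˡ _) (sum-zero λ j → zeroˡ (s (suc j)))) (+-identityʳ _)
  sum-δ (suc i) s = trans (+-cong (zeroˡ _) (sum-δ i (λ j → s (suc j)))) (+-identityˡ _)

  sum-≢ : ∀ {n} (i : Fin n) s → sum (λ j → indicator (not (toℕ i ≡ᵇ toℕ j)) * s j) ≈ sum s - s i
  sum-≢ i s = begin
    sum (λ j → indicator (not (toℕ i ≡ᵇ toℕ j)) * s j)
      ≈⟨ sum-cong-≋ (λ j → trans (*-congʳ (indicator-not (toℕ i ≡ᵇ toℕ j)))
           (solve 2 (λ b s → (con (1 , 0) :- b) :* s := s :+ :- (b :* s)) refl _ (s j))) ⟩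
    sum (λ j → s j + - (indicator (toℕ i ≡ᵇ toℕ j) * s j))
      ≈⟨ ∑-distrib-+ s _ ⟩
    sum s + sum (λ j → - (indicator (toℕ i ≡ᵇ toℕ j) * s j))
      ≈⟨ +-congˡ (trans (sum-neg (λ j → indicator (toℕ i ≡ᵇ toℕ j) * s j)) (-‿cong (sum-δ i s))) ⟩
    sum s - s i ∎

≡ᵇ-sym : ∀ m n → (m ≡ᵇ n) ≡ (n ≡ᵇ m)
≡ᵇ-sym zero    zero    = ≡.refl
≡ᵇ-sym zero    (suc n) = ≡.refl
≡ᵇ-sym (suc m) zero    = ≡.refl
≡ᵇ-sym (suc m) (suc n) = ≡ᵇ-sym m n

-- The generating function of walks between distinct colors

-- Walks without stationary steps have the transfer matrix (J - I) D, where J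
-- is the all-ones matrix and D = diag X; its resolvent is a rank one
-- perturbation of that of the diagonal matrix - D.
module Resolvent {c ℓ} (R : CommutativeRing c ℓ) where
  open CommutativeRing R hiding (zero)
  open Sums R
  -- The end `j` is fixed, so `p` is a single column of unknowns. The equation `p-step` separates
  -- the walk of one step from the longer ones, sorted by their first interior color k; only
  -- interior colors are weighted.
  module OffDiagonal {N : ℕ} (z E E′ F : Carrier) (X d : Fin N → Carrier)
    (d-inverse : ∀ i → d i * (1# + z * X i) ≈ 1#)
    (E′≈ : E′ ≈ E * sum (λ i → X i * d i))
    (F≈ : F ≈ E - z * E′)
    (j : Fin N) (p : Fin N → Carrier)
    (p-step : ∀ i → p i ≈ indicator (not (toℕ i ≡ᵇ toℕ j))
                        + z * sum (λ k → indicator (not (toℕ i ≡ᵇ toℕ k)) * (X k * p k)))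
    where
    open IntegerSolver R
    open import Relation.Binary.Reasoning.Setoid setoid

    s q : Carrier
    s = sum (λ i → X i * d i)
    q = sum (λ i → X i * p i)

    -- Completing the sum over k ≠ i to the full sum `q` moves the excluded stationary step to the
    -- left side, where it becomes the factor 1 + z Xᵢ that `d i` inverts.
    p≈ : ∀ i → p i ≈ d i * (indicator (not (toℕ i ≡ᵇ toℕ j)) + z * q)
    p≈ i = begin
      p i                           ≈⟨ *-identityˡ _ ⟨
      1# * p i                      ≈⟨ *-congʳ (d-inverse i) ⟨
      d i * (1# + z * X i) * p i
        ≈⟨ solve 4 (λ d z x p → d :* (con (1 , 0) :+ z :* x) :* p := d :* (p :+ z :* (x :* p))) refl (d i) z (X i) (p i) ⟩
      d i * (p i + z * (X i * p i))
        ≈⟨ *-congˡ (+-congʳ (trans (p-step i) (+-congˡ (*-congˡ (sum-≢ i (λ k → X k * p k)))))) ⟩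
      d i * (b + z * (q - X i * p i) + z * (X i * p i))
        ≈⟨ solve 5 (λ d b z q y → d :* (b :+ z :* (q :- y) :+ z :* y) := d :* (b :+ z :* q)) refl (d i) b z q (X i * p i) ⟩
      d i * (b + z * q) ∎
      where b = indicator (not (toℕ i ≡ᵇ toℕ j))

    -- Weighting `p≈` by Xᵢ and summing leaves one scalar equation for the only remaining unknown
    -- `q`.
    q≈ : q ≈ (s - X j * d j) + s * (z * q)
    q≈ = begin
      sum (λ i → X i * p i)
        ≈⟨ sum-cong-≋ (λ i → trans (*-congˡ (p≈ i))
             (trans (solve 4 (λ x d b w → x :* (d :* (b :+ w)) := b :* (x :* d) :+ (x :* d) :* w) refl _ _ _ _)
               (+-congʳ (*-congʳ (reflexive (≡.cong (λ b → indicator (not b)) (≡ᵇ-sym (toℕ i) (toℕ j)))))))) ⟩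
      sum (λ i → indicator (not (toℕ j ≡ᵇ toℕ i)) * (X i * d i) + X i * d i * (z * q))
        ≈⟨ ∑-distrib-+ (λ i → indicator (not (toℕ j ≡ᵇ toℕ i)) * (X i * d i)) _ ⟩
      _ ≈⟨ +-cong (sum-≢ j (λ i → X i * d i)) (sym (*-distribʳ-sum (z * q) (λ i → X i * d i))) ⟩
      (s - X j * d j) + s * (z * q) ∎

    -- Solving `q≈` requires the denominator 1 - z s, and `F` is `E` times this denominator.
    F*q≈ : F * q ≈ E * (s - X j * d j)
    F*q≈ = begin
      F * q                    ≈⟨ *-congʳ (trans F≈ (+-congˡ (-‿cong (*-congˡ E′≈)))) ⟩
      (E - z * (E * s)) * q
        ≈⟨ solve 4 (λ e z s q → (e :- z :* (e :* s)) :* q := e :* (q :- s :* (z :* q))) refl E z s q ⟩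
      E * (q - s * (z * q))    ≈⟨ *-congˡ (+-congʳ q≈) ⟩
      E * ((s - X j * d j) + s * (z * q) - s * (z * q))
        ≈⟨ solve 3 (λ e t w → e :* (t :+ w :- w) := e :* t) refl E (s - X j * d j) (s * (z * q)) ⟩
      E * (s - X j * d j) ∎

    off-diagonal : ∀ i → (toℕ i ≡ᵇ toℕ j) ≡ false → p i * F ≈ E * (d i * d j)
    off-diagonal i i≢j = begin
      p i * F                      ≈⟨ *-congʳ (p≈ i) ⟩
      d i * (indicator (not (toℕ i ≡ᵇ toℕ j)) + z * q) * F
        ≈⟨ *-congʳ (*-congˡ (+-congʳ (reflexive (≡.cong (λ b → indicator (not b)) i≢j)))) ⟩
      d i * (1# + z * q) * F
        ≈⟨ solve 4 (λ d z q f → d :* (con (1 , 0) :+ z :* q) :* f := d :* (f :+ z :* (f :* q))) refl (d i) z q F ⟩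
      d i * (F + z * (F * q))
        ≈⟨ *-congˡ (+-cong (trans F≈ (+-congˡ (-‿cong (*-congˡ E′≈)))) (*-congˡ F*q≈)) ⟩
      d i * (E - z * (E * s) + z * (E * (s - X j * d j)))
        ≈⟨ solve 6 (λ d e z s x d′ → d :* (e :- z :* (e :* s) :+ z :* (e :* (s :- x :* d′)))
             := e :* d :* (con (1 , 0) :- z :* x :* d′)) refl (d i) E z s (X j) (d j) ⟩
      -- The sum `s` has cancelled. What is left of the end `j` is 1 - z Xⱼ dⱼ, which is dⱼ itself.
      E * d i * (1# - z * X j * d j)         ≈⟨ *-congˡ (+-congʳ (d-inverse j)) ⟨
      E * d i * (d j * (1# + z * X j) - z * X j * d j)
        ≈⟨ solve 5 (λ d e z x d′ → e :* d :* (d′ :* (con (1 , 0) :+ z :* x) :- z :* x :* d′)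
             := e :* (d :* d′)) refl (d i) E z (X j) (d j) ⟩
      E * (d i * d j) ∎

-- The identity in an arbitrary commutative ring

module CycleChordIdentity {c ℓ} (R : CommutativeRing c ℓ) where
  open CommutativeRing R hiding (zero)
  open Sums R
  -- Superscripts tell the values at x from those at y; `a` and `b` are the dᵢ at x and at y, `Gˣ`
  -- and `Gʸ` the inverses of `Fˣ` and `Fʸ`, and `P` and `Q` the walks along the two arcs. The
  -- difference x - y is not assumed to be cancellable.
  module Identity {N : ℕ} (x y Eˣ Eˣ′ Eˣ″ Fˣ Gˣ Eʸ Eʸ′ Eʸ″ Fʸ Gʸ : Carrier) (X a b : Fin N → Carrier)
    (a-inverse : ∀ i → a i * (1# + x * X i) ≈ 1#)
    (b-inverse : ∀ i → b i * (1# + y * X i) ≈ 1#)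
    (Eˣ′≈ : Eˣ′ ≈ Eˣ * sum (λ i → X i * a i))
    (Eʸ′≈ : Eʸ′ ≈ Eʸ * sum (λ i → X i * b i))
    (Eˣ″≈ : Eˣ″ ≈ Eˣ * (sum (λ i → X i * a i) * sum (λ i → X i * a i) - sum (λ i → (X i * a i) * (X i * a i))))
    (Eʸ″≈ : Eʸ″ ≈ Eʸ * (sum (λ i → X i * b i) * sum (λ i → X i * b i) - sum (λ i → (X i * b i) * (X i * b i))))
    (Fˣ≈ : Fˣ ≈ Eˣ - x * Eˣ′)
    (Fʸ≈ : Fʸ ≈ Eʸ - y * Eʸ′)
    (Gˣ-inverse : Fˣ * Gˣ ≈ 1#)
    (Gʸ-inverse : Fʸ * Gʸ ≈ 1#)
    (P Q : Fin N → Fin N → Carrier)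
    (P≈ : ∀ i j → (toℕ i ≡ᵇ toℕ j) ≡ false → P i j ≈ Eˣ * (a i * a j) * Gˣ)
    (Q≈ : ∀ i j → (toℕ i ≡ᵇ toℕ j) ≡ false → Q i j ≈ Eʸ * (b i * b j) * Gʸ)
    where
    open IntegerSolver R
    open import Relation.Binary.Reasoning.Setoid setoid
    open import Algebra.Definitions.RawSemiring (RawRing.rawSemiring rawRing)
      using (_^_) renaming (_×_ to _·_)

    u v w : Fin N → Carrier
    u i = X i * a i
    v i = X i * b i
    w i = X i * a i * b i

    S T S₂ T₂ UV W W₂ : Carrier
    S  = sum u
    T  = sum v
    S₂ = sum (λ i → u i * u i)
    T₂ = sum (λ i → v i * v i)
    UV = sum (λ i → u i * v i)
    W  = sum w
    W₂ = sum (λ i → w i * w i)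

    sum-linear : ∀ r s (f g : Fin N → Carrier) → sum (λ i → r * f i + s * g i) ≈ r * sum f + s * sum g
    sum-linear r s f g = trans (∑-distrib-+ (λ i → r * f i) (λ i → s * g i))
      (+-cong (sym (*-distribˡ-sum r f)) (sym (*-distribˡ-sum s g)))

    -- This is x (1 + y Xᵢ) - y (1 + x Xᵢ) = x - y, divided by both linear factors.
    w-fractions : ∀ i → (x - y) * w i ≈ x * u i + (- y) * v i
    w-fractions i = begin
      (x - y) * w i
        ≈⟨ solve 5 (λ x y X a b → (x :- y) :* (X :* a :* b) :=
             x :* (X :* a) :* (b :* (con (1 , 0) :+ y :* X)) :- y :* (X :* b) :* (a :* (con (1 , 0) :+ x :* X)))
             refl x y (X i) (a i) (b i) ⟩
      x * u i * (b i * (1# + y * X i)) - y * v i * (a i * (1# + x * X i))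
        ≈⟨ +-cong (*-congˡ (b-inverse i)) (-‿cong (*-congˡ (a-inverse i))) ⟩
      x * u i * 1# - y * v i * 1#
        ≈⟨ solve 4 (λ x y u v → x :* u :* con (1 , 0) :- y :* v :* con (1 , 0) := x :* u :+ (:- y) :* v) refl x y (u i) (v i) ⟩
      x * u i + (- y) * v i ∎

    -- This is (1 + x Xᵢ) - (1 + y Xᵢ) = (x - y) Xᵢ, divided by both linear factors.
    uv-fractions : ∀ i → (x - y) * (u i * v i) ≈ 1# * v i + (- 1#) * u i
    uv-fractions i = begin
      (x - y) * (u i * v i)
        ≈⟨ solve 5 (λ x y X a b → (x :- y) :* ((X :* a) :* (X :* b)) :=
             (X :* b) :* (a :* (con (1 , 0) :+ x :* X)) :- (X :* a) :* (b :* (con (1 , 0) :+ y :* X)))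
             refl x y (X i) (a i) (b i) ⟩
      v i * (a i * (1# + x * X i)) - u i * (b i * (1# + y * X i))
        ≈⟨ +-cong (*-congˡ (a-inverse i)) (-‿cong (*-congˡ (b-inverse i))) ⟩
      v i * 1# - u i * 1#
        ≈⟨ solve 2 (λ u v → v :* con (1 , 0) :- u :* con (1 , 0) := con (1 , 0) :* v :+ (:- con (1 , 0)) :* u) refl (u i) (v i) ⟩
      1# * v i + (- 1#) * u i ∎

    W≈ : (x - y) * W ≈ x * S - y * T
    W≈ = begin
      (x - y) * W                          ≈⟨ *-distribˡ-sum (x - y) w ⟩
      sum (λ i → (x - y) * w i)            ≈⟨ sum-cong-≋ w-fractions ⟩
      sum (λ i → x * u i + (- y) * v i)    ≈⟨ sum-linear x (- y) u v ⟩
      x * S + (- y) * T                    ≈⟨ solve 4 (λ x y S T → x :* S :+ (:- y) :* T := x :* S :- y :* T) refl x y S T ⟩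
      x * S - y * T                        ∎

    UV≈ : (x - y) * UV ≈ T - S
    UV≈ = begin
      (x - y) * UV                         ≈⟨ *-distribˡ-sum (x - y) (λ i → u i * v i) ⟩
      sum (λ i → (x - y) * (u i * v i))    ≈⟨ sum-cong-≋ uv-fractions ⟩
      sum (λ i → 1# * v i + (- 1#) * u i)  ≈⟨ sum-linear 1# (- 1#) v u ⟩
      1# * T + (- 1#) * S
        ≈⟨ solve 2 (λ S T → con (1 , 0) :* T :+ (:- con (1 , 0)) :* S := T :- S) refl S T ⟩
      T - S ∎

    W₂≈ : (x - y) * ((x - y) * W₂) ≈ x * x * S₂ + y * y * T₂ - (x * y + x * y) * UV
    W₂≈ = begin
      (x - y) * ((x - y) * W₂)
        ≈⟨ solve 2 (λ d W → d :* (d :* W) := (d :* d) :* W) refl (x - y) W₂ ⟩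
      ((x - y) * (x - y)) * W₂
        ≈⟨ *-distribˡ-sum ((x - y) * (x - y)) (λ i → w i * w i) ⟩
      sum (λ i → ((x - y) * (x - y)) * (w i * w i))
        ≈⟨ sum-cong-≋ (λ i → trans (solve 2 (λ d w → (d :* d) :* (w :* w) := (d :* w) :* (d :* w)) refl (x - y) (w i))
             (trans (*-cong (w-fractions i) (w-fractions i))
             (solve 4 (λ x y u v → (x :* u :+ (:- y) :* v) :* (x :* u :+ (:- y) :* v) :=
               con (1 , 0) :* (x :* x :* (u :* u) :+ y :* y :* (v :* v)) :+ (:- (x :* y :+ x :* y)) :* (u :* v))
               refl x y (u i) (v i)))) ⟩
      sum (λ i → 1# * (x * x * (u i * u i) + y * y * (v i * v i)) + (- (x * y + x * y)) * (u i * v i))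
        ≈⟨ sum-linear 1# (- (x * y + x * y)) (λ i → x * x * (u i * u i) + y * y * (v i * v i)) (λ i → u i * v i) ⟩
      1# * sum (λ i → x * x * (u i * u i) + y * y * (v i * v i)) + (- (x * y + x * y)) * UV
        ≈⟨ +-congʳ (*-congˡ (sum-linear (x * x) (y * y) (λ i → u i * u i) (λ i → v i * v i))) ⟩
      1# * (x * x * S₂ + y * y * T₂) + (- (x * y + x * y)) * UV
        ≈⟨ solve 3 (λ p q r → con (1 , 0) :* p :+ (:- q) :* r := p :- q :* r) refl _ _ _ ⟩
      x * x * S₂ + y * y * T₂ - (x * y + x * y) * UV ∎

    D : Carrier
    D = sum (λ i → sum (λ j → indicator (not (toℕ i ≡ᵇ toℕ j)) * ((X i * P i j) * (X j * Q j i))))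

    D≈ : D ≈ (Eˣ * Eʸ) * (Gˣ * Gʸ) * (W * W - W₂)
    D≈ = begin
      D ≈⟨ sum-cong-≋ (λ i → trans (sum-cong-≋ (λ j → term i j)) (sum-≢ i (λ j → K * (w i * w j)))) ⟩
      sum (λ i → sum (λ j → K * (w i * w j)) - K * (w i * w i))
        ≈⟨ sum-cong-≋ (λ i → +-cong (trans (sym (*-distribˡ-sum K (λ j → w i * w j)))
                                            (*-congˡ (trans (sym (*-distribˡ-sum (w i) w)) (*-comm _ _))))
                            (solve 2 (λ k w → :- (k :* w) := (:- k) :* w) refl K (w i * w i))) ⟩
      sum (λ i → K * (W * w i) + (- K) * (w i * w i))
        ≈⟨ sum-linear K (- K) (λ i → W * w i) (λ i → w i * w i) ⟩
      K * sum (λ i → W * w i) + (- K) * W₂    ≈⟨ +-congʳ (*-congˡ (sym (*-distribˡ-sum W w))) ⟩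
      K * (W * W) + (- K) * W₂
        ≈⟨ solve 3 (λ k p q → k :* p :+ (:- k) :* q := k :* (p :- q)) refl K (W * W) W₂ ⟩
      K * (W * W - W₂) ∎
      where
      K = (Eˣ * Eʸ) * (Gˣ * Gʸ)

      term : ∀ i j → indicator (not (toℕ i ≡ᵇ toℕ j)) * ((X i * P i j) * (X j * Q j i))
                   ≈ indicator (not (toℕ i ≡ᵇ toℕ j)) * (K * (w i * w j))
      term i j with toℕ i ≡ᵇ toℕ j in i≟j
      ... | true  = trans (zeroˡ _) (sym (zeroˡ _))
      ... | false = *-congˡ (begin
        (X i * P i j) * (X j * Q j i)
          ≈⟨ *-cong (*-congˡ (P≈ i j i≟j)) (*-congˡ (Q≈ j i (≡.trans (≡ᵇ-sym (toℕ j) (toℕ i)) i≟j))) ⟩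
        (X i * (Eˣ * (a i * a j) * Gˣ)) * (X j * (Eʸ * (b j * b i) * Gʸ))
          ≈⟨ solve 10 (λ X a b X′ a′ b′ E G E′ G′ →
               (X :* (E :* (a :* a′) :* G)) :* (X′ :* (E′ :* (b′ :* b) :* G′))
               := (E :* E′) :* (G :* G′) :* ((X :* a :* b) :* (X′ :* a′ :* b′)))
               refl (X i) (a i) (b i) (X j) (a j) (b j) Eˣ Gˣ Eʸ Gʸ ⟩
        K * (w i * w j) ∎)

    -- Two of the three factors turn every `w` into `u` and `v`; the third one is spent on the cross
    -- sum `UV` inside `W₂`.
    [x-y]³W²-W₂ : (x - y) * ((x - y) * ((x - y) * (W * W - W₂)))
      ≈ (x - y) * (x * x * (S * S - S₂) + y * y * (T * T - T₂) - (x * y + x * y) * (S * T))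
        + (x * y + x * y) * (T - S)
    [x-y]³W²-W₂ = begin
      (x - y) * ((x - y) * ((x - y) * (W * W - W₂)))
        ≈⟨ solve 3 (λ d p q → d :* (d :* (d :* (p :* p :- q)))
               := d :* ((d :* p) :* (d :* p) :- d :* (d :* q))) refl (x - y) W W₂ ⟩
      (x - y) * (((x - y) * W) * ((x - y) * W) - (x - y) * ((x - y) * W₂))
        ≈⟨ *-congˡ (+-cong (*-cong W≈ W≈) (-‿cong W₂≈)) ⟩
      (x - y) * ((x * S - y * T) * (x * S - y * T) - (x * x * S₂ + y * y * T₂ - (x * y + x * y) * UV))
        ≈⟨ solve 7 (λ x y S T S₂ T₂ R → (x :- y) :* ((x :* S :- y :* T) :* (x :* S :- y :* T)
               :- (x :* x :* S₂ :+ y :* y :* T₂ :- (x :* y :+ x :* y) :* R))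
             := (x :- y) :* (x :* x :* (S :* S :- S₂) :+ y :* y :* (T :* T :- T₂) :- (x :* y :+ x :* y) :* (S :* T))
             :+ (x :* y :+ x :* y) :* ((x :- y) :* R)) refl x y S T S₂ T₂ UV ⟩
      (x - y) * (x * x * (S * S - S₂) + y * y * (T * T - T₂) - (x * y + x * y) * (S * T))
        + (x * y + x * y) * ((x - y) * UV)
        ≈⟨ +-congˡ (*-congˡ UV≈) ⟩
      _ ∎

    numerator : Carrier
    numerator = (x - y) * (x * x * Eˣ″ * Eʸ + y * y * Eʸ″ * Eˣ - (x * y + x * y) * (Eˣ′ * Eʸ′))
        + (x * y + x * y) * (Eʸ′ * Eˣ - Eˣ′ * Eʸ)

    numerator≈ : (Eˣ * Eʸ) * ((x - y) * ((x - y) * ((x - y) * (W * W - W₂)))) ≈ numerator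
    numerator≈ = begin
      (Eˣ * Eʸ) * ((x - y) * ((x - y) * ((x - y) * (W * W - W₂)))) ≈⟨ *-congˡ [x-y]³W²-W₂ ⟩
      (Eˣ * Eʸ) * ((x - y) * (x * x * (S * S - S₂) + y * y * (T * T - T₂) - (x * y + x * y) * (S * T))
        + (x * y + x * y) * (T - S))
        ≈⟨ solve 8 (λ x y E F S T p q → (E :* F)
               :* ((x :- y) :* (x :* x :* p :+ y :* y :* q :- (x :* y :+ x :* y) :* (S :* T))
               :+ (x :* y :+ x :* y) :* (T :- S))
             := (x :- y) :* (x :* x :* (E :* p) :* F :+ y :* y :* (F :* q) :* E
                 :- (x :* y :+ x :* y) :* ((E :* S) :* (F :* T)))
               :+ (x :* y :+ x :* y) :* ((F :* T) :* E :- (E :* S) :* F))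
             refl x y Eˣ Eʸ S T (S * S - S₂) (T * T - T₂) ⟩
      (x - y) * (x * x * (Eˣ * (S * S - S₂)) * Eʸ + y * y * (Eʸ * (T * T - T₂)) * Eˣ
                 - (x * y + x * y) * ((Eˣ * S) * (Eʸ * T)))
        + (x * y + x * y) * ((Eʸ * T) * Eˣ - (Eˣ * S) * Eʸ)
        ≈⟨ +-cong (*-congˡ (+-cong (+-cong (*-congʳ (*-congˡ Eˣ″≈)) (*-congʳ (*-congˡ Eʸ″≈)))
                                     (-‿cong (*-congˡ (*-cong Eˣ′≈ Eʸ′≈)))))
                  (*-congˡ (+-cong (*-congʳ Eʸ′≈) (-‿cong (*-congʳ Eˣ′≈)))) ⟨
      numerator ∎

    fractions : Eˣ′ * Gˣ - Eʸ′ * Gʸ ≈ (Eˣ′ * Fʸ - Eʸ′ * Fˣ) * (Gˣ * Gʸ)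
    fractions = begin
      Eˣ′ * Gˣ - Eʸ′ * Gʸ
        ≈⟨ solve 4 (λ e g e′ g′ → e :* g :- e′ :* g′ := e :* g :* con (1 , 0) :- e′ :* g′ :* con (1 , 0)) refl Eˣ′ Gˣ Eʸ′ Gʸ ⟩
      Eˣ′ * Gˣ * 1# - Eʸ′ * Gʸ * 1#    ≈⟨ +-cong (*-congˡ Gʸ-inverse) (-‿cong (*-congˡ Gˣ-inverse)) ⟨
      Eˣ′ * Gˣ * (Fʸ * Gʸ) - Eʸ′ * Gʸ * (Fˣ * Gˣ)
        ≈⟨ solve 6 (λ e g f e′ g′ f′ → e :* g :* (f′ :* g′) :- e′ :* g′ :* (f :* g) := (e :* f′ :- e′ :* f) :* (g :* g′))
             refl Eˣ′ Gˣ Fˣ Eʸ′ Gʸ Fʸ ⟩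
      (Eˣ′ * Fʸ - Eʸ′ * Fˣ) * (Gˣ * Gʸ) ∎

    identity : (x - y) ^ 3 * (x * y * D)
      ≈ x * y * ((x - y) * ((x ^ 2 * Eˣ″ * Eʸ + y ^ 2 * Eʸ″ * Eˣ) * (Gˣ * Gʸ))
                 - 2 · (x * y) * (Eˣ′ * Gˣ - Eʸ′ * Gʸ))
    identity = begin
      (x - y) ^ 3 * (x * y * D)      ≈⟨ *-congˡ (*-congˡ D≈) ⟩
      (x - y) ^ 3 * (x * y * ((Eˣ * Eʸ) * (Gˣ * Gʸ) * (W * W - W₂)))
        ≈⟨ solve 5 (λ d p e g w → (d :* (d :* (d :* con (1 , 0)))) :* (p :* (e :* g :* w)) := p :* (g :* (e :* (d :* (d :* (d :* w))))))
             refl (x - y) (x * y) (Eˣ * Eʸ) (Gˣ * Gʸ) (W * W - W₂) ⟩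
      x * y * ((Gˣ * Gʸ) * ((Eˣ * Eʸ) * ((x - y) * ((x - y) * ((x - y) * (W * W - W₂))))))
        ≈⟨ *-congˡ (*-congˡ numerator≈) ⟩
      x * y * ((Gˣ * Gʸ) * numerator)
        -- The product `Eˣ′ * Eʸ′` has no separate term in the claim: in Eˣ′ Fʸ - Eʸ′ Fˣ, the parts
        -- - y Eʸ′ and - x Eˣ′ of `Fʸ` and `Fˣ` contribute exactly (x - y) Eˣ′ Eʸ′.
        ≈⟨ *-congˡ (solve 9 (λ x y G Ex Ex′ Ex″ Ey Ey′ Ey″ →
             G :* ((x :- y) :* (x :* x :* Ex″ :* Ey :+ y :* y :* Ey″ :* Ex :- (x :* y :+ x :* y) :* (Ex′ :* Ey′))
               :+ (x :* y :+ x :* y) :* (Ey′ :* Ex :- Ex′ :* Ey))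
             := (x :- y) :* (((x :* (x :* con (1 , 0))) :* Ex″ :* Ey :+ (y :* (y :* con (1 , 0))) :* Ey″ :* Ex) :* G)
               :- ((x :* y) :+ ((x :* y) :+ con (0 , 0))) :* ((Ex′ :* (Ey :- y :* Ey′) :- Ey′ :* (Ex :- x :* Ex′)) :* G))
             refl x y (Gˣ * Gʸ) Eˣ Eˣ′ Eˣ″ Eʸ Eʸ′ Eʸ″) ⟩
      x * y * ((x - y) * ((x ^ 2 * Eˣ″ * Eʸ + y ^ 2 * Eʸ″ * Eˣ) * (Gˣ * Gʸ))
                 - 2 · (x * y) * ((Eˣ′ * (Eʸ - y * Eʸ′) - Eʸ′ * (Eˣ - x * Eˣ′)) * (Gˣ * Gʸ)))
        ≈⟨ *-congˡ (+-congˡ (-‿cong (*-congˡ (trans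
               (*-congʳ (+-cong (*-congˡ (sym Fʸ≈)) (-‿cong (*-congˡ (sym Fˣ≈))))) (sym fractions))))) ⟩
      _ ∎

-- The ring of series at monomials with N exponents

infix 4 _≈[_]_
-- The length is exactly N: at a list of length N, `convolve` evaluates its factors only at lists of
-- length N. Each length thus gives a ring by itself, and no compatibility between lengths is used.
_≈[_]_ : Λ → ℕ → Λ → Set
f ≈[ N ] g = ∀ α → length α ≡ N → f α ≡ g α

rawRing[_] : ℕ → RawRing 0ℓ 0ℓ
rawRing[ N ] = record ℤ⟦x₁,x₂,…⟧ { _≈_ = _≈[ N ]_ }

-- A series in x₁ , x₂ , … is a series in x₁ over the series in x₂ , x₃ , ….
inFirst : Λ → ℕ → Λ
inFirst f a α = f (a ∷ α)

sumΛ-coefficient : ∀ {n} (s : Fin n → Λ) α → sumΛ s α ≡ sumℤ (λ i → s i α)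
sumΛ-coefficient {zero}  s α = ≡.refl
sumΛ-coefficient {suc n} s α = ≡.cong (ℤ._+_ (s zero α)) (sumΛ-coefficient (s ∘ suc) α)

-- The two products differ only in order of evaluation: `convolve` adds integers at a fixed
-- monomial, the product of series adds elements of `Λ`.
inFirst-* : ∀ f g a α → convolve f g (a ∷ α) ≡ RawRing._*_ (PowerSeries.rawRing ℤ⟦x₁,x₂,…⟧) (inFirst f) (inFirst g) a α
inFirst-* f g a α = ≡.sym (sumΛ-coefficient {suc a} (λ i → convolve (inFirst f (toℕ i)) (inFirst g (a ∸ toℕ i))) α)

-- By induction on N, the laws are pulled back along the injection `inFirst` from power series over
-- the ring for one indeterminate less, and at N = 0 from the integers.
isCommutativeRing[_] : ∀ N → IsCommutativeRingUnder ℤ⟦x₁,x₂,…⟧ _≈[ N ]_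
isCommutativeRing[ zero ] = RingMonomorphism.isCommutativeRing monomorphism ℤ.+-*-isCommutativeRing
  where
  monomorphism : IsRingMonomorphism rawRing[ 0 ] ℤ.+-*-rawRing (λ f → f [])
  monomorphism = record
    { isRingHomomorphism = isRingHomomorphism record
      { cong   = λ f≈g → f≈g [] ≡.refl
      ; +-homo = λ f g → ≡.refl
      ; *-homo = λ f g → ≡.refl
      ; -‿homo = λ f → ≡.refl
      ; 0-homo = ≡.refl
      ; 1-homo = ≡.refl
      }
    ; injective = λ { f≈g [] ≡.refl → f≈g }
    }
isCommutativeRing[ suc N ] = RingMonomorphism.isCommutativeRing monomorphism (CommutativeRing.isCommutativeRing seriesRing)
  where
  open SeriesProperties ℤ⟦x₁,x₂,…⟧ _≈[ N ]_ isCommutativeRing[ N ] using (seriesRing)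

  monomorphism : IsRingMonomorphism rawRing[ suc N ] (CommutativeRing.rawRing seriesRing) inFirst
  monomorphism = record
    { isRingHomomorphism = isRingHomomorphism record
      { cong   = λ f≈g a α N≡ → f≈g (a ∷ α) (≡.cong suc N≡)
      ; +-homo = λ f g a α N≡ → ≡.refl
      ; *-homo = λ f g a α N≡ → inFirst-* f g a α
      ; -‿homo = λ f a α N≡ → ≡.refl
      ; 0-homo = λ a α N≡ → ≡.refl
      ; 1-homo = λ { zero α N≡ → ≡.refl ; (suc a) α N≡ → ≡.refl }
      }
    ; injective = λ { f≈g (a ∷ α) ≡.refl → f≈g a α ≡.refl }
    }

ring[_] : ℕ → CommutativeRing 0ℓ 0ℓ
ring[ N ] = record { isCommutativeRing = isCommutativeRing[ N ] }

-- The monomial of a coloring as a product of indeterminates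

-- var i stands for the indeterminate with index i + 1.
var : ℕ → Λ
var i       []      = ℤ.0ℤ
var zero    (a ∷ α) = PowerSeries.indeterminate ℤ⟦x₁,x₂,…⟧ a α
var (suc i) (a ∷ α) = PowerSeries.constant ℤ⟦x₁,x₂,…⟧ (var i) a α

monomial : Monomial → Λ
monomial γ α = if does (List.≡-dec ℕ._≟_ γ α) then ℤ.1ℤ else ℤ.0ℤ

increment : ℕ → Monomial → Monomial
increment i       []      = []
increment zero    (c ∷ γ) = suc c ∷ γ
increment (suc i) (c ∷ γ) = c ∷ increment i γ

monomial-∷ : ∀ c γ a α → monomial (c ∷ γ) (a ∷ α) ≡ (if c ≡ᵇ a then monomial γ α else ℤ.0ℤ)
monomial-∷ c γ a α with c ≡ᵇ a
... | true  = ≡.refl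
... | false = ≡.refl

-- The bound i < N matters: beyond it `var i` vanishes on lists of length N, whereas `increment i`
-- leaves the exponents unchanged.
var-monomial : ∀ N i γ → i < N → length γ ≡ N → convolve (var i) (monomial γ) ≈[ N ] monomial (increment i γ)
var-monomial (suc N) zero (c ∷ γ) i<N ≡.refl (a ∷ α) α≡N =
  ≡.trans (inFirst-* (var 0) (monomial (c ∷ γ)) a α) (step a α (ℕ.suc-injective α≡N))
  where
  open SeriesProperties ℤ⟦x₁,x₂,…⟧ _≈[ N ]_ isCommutativeRing[ N ]
  step : ∀ a α → length α ≡ N →
    (indeterminate *ˢ inFirst (monomial (c ∷ γ))) a α ≡ monomial (suc c ∷ γ) (a ∷ α)
  step zero    α α≡N = indeterminate-*₀ (inFirst (monomial (c ∷ γ))) α α≡N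
  step (suc a) α α≡N = indeterminate-* (inFirst (monomial (c ∷ γ))) a α α≡N
var-monomial (suc N) (suc i) (c ∷ γ) (s<s i<N) ≡.refl (a ∷ α) α≡N = begin
  convolve (var (suc i)) (monomial (c ∷ γ)) (a ∷ α)
    ≡⟨ inFirst-* (var (suc i)) (monomial (c ∷ γ)) a α ⟩
  (constant (var i) *ˢ inFirst (monomial (c ∷ γ))) a α
    ≡⟨ constant-* (var i) (inFirst (monomial (c ∷ γ))) a α (ℕ.suc-injective α≡N) ⟩
  convolve (var i) (inFirst (monomial (c ∷ γ)) a) α
    ≡⟨ *-congˡ {var i} (λ β _ → monomial-∷ c γ a β) α (ℕ.suc-injective α≡N) ⟩
  convolve (var i) (λ β → if c ≡ᵇ a then monomial γ β else ℤ.0ℤ) α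
    ≡⟨ step (c ≡ᵇ a) ⟩
  (if c ≡ᵇ a then monomial (increment i γ) α else ℤ.0ℤ)
    ≡⟨ monomial-∷ c (increment i γ) a α ⟨
  monomial (c ∷ increment i γ) (a ∷ α) ∎
  where
  open ≡.≡-Reasoning
  open CommutativeRing ring[ N ] using (*-congˡ; zeroʳ)
  open SeriesProperties ℤ⟦x₁,x₂,…⟧ _≈[ N ]_ isCommutativeRing[ N ] using (constant; _*ˢ_; constant-*)
  step : ∀ b → convolve (var i) (λ β → if b then monomial γ β else ℤ.0ℤ) α
             ≡ (if b then monomial (increment i γ) α else ℤ.0ℤ)
  step true  = var-monomial N i γ i<N ≡.refl α (ℕ.suc-injective α≡N)
  step false = zeroʳ (var i) α (ℕ.suc-injective α≡N)

weight : ∀ {n} → Vec ℕ n → Λ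
weight []      = one
weight (i ∷ κ) = convolve (var i) (weight κ)

one≡monomial : ∀ N α → length α ≡ N → one α ≡ monomial (applyUpTo (λ _ → 0) N) α
one≡monomial zero    []          _   = ≡.refl
one≡monomial (suc N) (zero  ∷ α) α≡N =
  ≡.trans (one≡monomial N α (ℕ.suc-injective α≡N)) (≡.sym (monomial-∷ 0 (applyUpTo (λ _ → 0) N) 0 α))
one≡monomial (suc N) (suc a ∷ α) α≡N = ≡.sym (monomial-∷ 0 (applyUpTo (λ _ → 0) N) (suc a) α)

-- The conditional has the form to which `Vec.count` reduces when the color i is put in front of a
-- coloring.
increment-applyUpTo : ∀ {N i} → i < N → ∀ f →
  applyUpTo (λ j → (if does (j ℕ.≟ i) then suc else id) (f j)) N ≡ increment i (applyUpTo f N)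
increment-applyUpTo {suc N} {zero}  i<N       f = ≡.refl
increment-applyUpTo {suc N} {suc i} (s<s i<N) f = ≡.cong (f 0 ∷_) (increment-applyUpTo i<N (f ∘ suc))

exponents-∷ : ∀ {N n i} → i < N → (κ : Vec ℕ n) → exponents N (i ∷ κ) ≡ increment i (exponents N κ)
exponents-∷ {N} {i = i} i<N κ = begin
  exponents N (i ∷ κ)                                        ≡⟨ List.map-upTo _ N ⟩
  applyUpTo (λ j → Vec.count (j ℕ.≟_) (i ∷ κ)) N             ≡⟨ increment-applyUpTo i<N _ ⟩
  increment i (applyUpTo (λ j → Vec.count (j ℕ.≟_) κ) N)     ≡⟨ ≡.cong (increment i) (List.map-upTo _ N) ⟨
  increment i (exponents N κ)                                ∎
  where open ≡.≡-Reasoning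

weight≈monomial : ∀ N {n} (κ : Vec ℕ n) → All (_< N) κ → weight κ ≈[ N ] monomial (exponents N κ)
weight≈monomial N []      []          α α≡N =
  ≡.trans (one≡monomial N α α≡N) (≡.cong (λ γ → monomial γ α) (≡.sym (List.map-upTo (λ _ → 0) N)))
weight≈monomial N (i ∷ κ) (i<N ∷ κ<N) α α≡N = begin
  convolve (var i) (weight κ) α
    ≡⟨ CommutativeRing.*-congˡ ring[ N ] {var i} (weight≈monomial N κ κ<N) α α≡N ⟩
  convolve (var i) (monomial (exponents N κ)) α
    ≡⟨ var-monomial N i (exponents N κ) i<N (≡.trans (List.length-map _ (upTo N)) (List.length-upTo N)) α α≡N ⟩
  monomial (increment i (exponents N κ)) α
    ≡⟨ ≡.cong (λ γ → monomial γ α) (exponents-∷ i<N κ) ⟨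
  monomial (exponents N (i ∷ κ)) α ∎
  where open ≡.≡-Reasoning

-- From counting colorings to iterated sums over colors

module ColorSums {c ℓ} (R : RawRing c ℓ) (N : ℕ) where
  open RawSemiringDefinitions (RawRing.rawSemiring R) using (sum)

  -- A raw ring suffices as parameter, so that one definition serves for sums in `Λ` and for the
  -- sums of integers formed by their coefficients.
  ∑ : ∀ n → (Vec ℕ n → RawRing.Carrier R) → RawRing.Carrier R
  ∑ zero    g = g []
  ∑ (suc n) g = sum {N} (λ i → ∑ n (λ κ → g (toℕ i ∷ κ)))

module _ {A B : Set} {P : Unary.Pred B 0ℓ} (P? : Unary.Decidable P) (f : A → B) where
  length-filter-map : ∀ as → length (filter P? (List.map f as)) ≡ length (filter (P? ∘ f) as)
  length-filter-map []       = ≡.refl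
  length-filter-map (a ∷ as) with does (P? (f a))
  ... | true  = ≡.cong suc (length-filter-map as)
  ... | false = length-filter-map as

length-filter-vectors : ∀ N n {P : Unary.Pred (Vec ℕ n) 0ℓ} (P? : Unary.Decidable P) →
  + length (filter P? (vectors (upTo N) n))
    ≡ ColorSums.∑ ℤ.+-*-rawRing N n (λ κ → if does (P? κ) then ℤ.1ℤ else ℤ.0ℤ)
length-filter-vectors N zero    P? with does (P? [])
... | true  = ≡.refl
... | false = ≡.refl
length-filter-vectors N (suc n) P? = ≡.trans (split N id) (sum-cong {N} λ i → length-filter-vectors N n (P? ∘ (toℕ i ∷_)))
  where
  open SeriesProperties ℤ.+-*-rawRing _≡_ ℤ.+-*-isCommutativeRing using (sum-cong)
  open ≡.≡-Reasoning
  vs = vectors (upTo N) n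

  -- The tail of `upTo` is no longer of the form `upTo`, so the induction runs over `applyUpTo f`
  -- with arbitrary `f`.
  split : ∀ M f → + length (filter P? (cartesianProductWith _∷_ (applyUpTo f M) vs))
        ≡ sumℤ {M} (λ i → + length (filter (P? ∘ (f (toℕ i) ∷_)) vs))
  split zero    f = ≡.refl
  split (suc M) f = begin
    + length (filter P? (List.map (f 0 ∷_) vs ++ rest))
      ≡⟨ ≡.cong (+_ ∘ length) (List.filter-++ P? (List.map (f 0 ∷_) vs) rest) ⟩
    + length (filter P? (List.map (f 0 ∷_) vs) ++ filter P? rest)
      ≡⟨ ≡.cong +_ (List.length-++ (filter P? (List.map (f 0 ∷_) vs))) ⟩
    + length (filter P? (List.map (f 0 ∷_) vs)) ℤ.+ + length (filter P? rest)
      ≡⟨ ≡.cong₂ (λ p q → + p ℤ.+ q) (length-filter-map P? (f 0 ∷_) vs) (split M (f ∘ suc)) ⟩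
    sumℤ {suc M} (λ i → + length (filter (P? ∘ (f (toℕ i) ∷_)) vs)) ∎
    where rest = cartesianProductWith _∷_ (applyUpTo (f ∘ suc) M) vs

∑-coefficient : ∀ N n (g : Vec ℕ n → Λ) α →
  ColorSums.∑ ℤ⟦x₁,x₂,…⟧ N n g α ≡ ColorSums.∑ ℤ.+-*-rawRing N n (λ κ → g κ α)
∑-coefficient N zero    g α = ≡.refl
∑-coefficient N (suc n) g α = ≡.trans (sumΛ-coefficient {N} _ α)
  (SeriesProperties.sum-cong ℤ.+-*-rawRing _≡_ ℤ.+-*-isCommutativeRing {N} λ i → ∑-coefficient N n (g ∘ (toℕ i ∷_)) α)

∑ℤ-cong : ∀ N n {g h : Vec ℕ n → ℤ} → (∀ κ → All (_< N) κ → g κ ≡ h κ) →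
  ColorSums.∑ ℤ.+-*-rawRing N n g ≡ ColorSums.∑ ℤ.+-*-rawRing N n h
∑ℤ-cong N zero    g≡h = g≡h [] []
∑ℤ-cong N (suc n) g≡h = SeriesProperties.sum-cong ℤ.+-*-rawRing _≡_ ℤ.+-*-isCommutativeRing {N}
  λ i → ∑ℤ-cong N n λ κ κ<N → g≡h (toℕ i ∷ κ) (Fin.toℕ<n i ∷ κ<N)

-- Increasing sequences, walks and proper colorings

IncreasingFrom : ∀ {n} → ℕ → Vec ℕ n → Set
IncreasingFrom m []      = ⊤
IncreasingFrom m (i ∷ κ) = m ≤ i × IncreasingFrom (suc i) κ

-- The explicit lower bound lets the decision unfold to a conjunction of a test of the first color
-- and a condition on the rest, from which the sum recursion is read off.
increasingFrom? : ∀ {n} m (κ : Vec ℕ n) → Dec (IncreasingFrom m κ)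
increasingFrom? m []      = yes tt
increasingFrom? m (i ∷ κ) = m ℕ.≤? i ×-dec increasingFrom? (suc i) κ

linked⇒increasing : ∀ {n i} {κ : Vec ℕ n} → Linked _<_ (i ∷ κ) → IncreasingFrom (suc i) κ
linked⇒increasing {κ = []}    _            = tt
linked⇒increasing {κ = j ∷ κ} (i<j ∷ rest) = i<j , linked⇒increasing rest

increasing⇒linked : ∀ {n i} {κ : Vec ℕ n} → IncreasingFrom (suc i) κ → Linked _<_ (i ∷ κ)
increasing⇒linked {κ = []}    _            = [-]
increasing⇒linked {κ = j ∷ κ} (i<j , rest) = i<j ∷ increasing⇒linked rest

linked⇔increasing : ∀ {n} (κ : Vec ℕ n) → Linked _<_ κ ⇔ IncreasingFrom 0 κ
linked⇔increasing []      = mk⇔ (λ _ → tt) (λ _ → [])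
linked⇔increasing (i ∷ κ) = mk⇔ (λ l → z≤n , linked⇒increasing l) (λ { (_ , r) → increasing⇒linked r })

-- The vector holds the interior colors only. Two walks with common ends can thus be glued to a
-- cycle without weighting an end twice, and the empty vector is a single edge.
Walk : ∀ {n} → ℕ → Vec ℕ n → ℕ → Set
Walk i []      j = i ≢ j
Walk i (k ∷ κ) j = i ≢ k × Walk k κ j

walk? : ∀ {n} i (κ : Vec ℕ n) j → Dec (Walk i κ j)
walk? i []      j = ¬? (i ℕ.≟ j)
walk? i (k ∷ κ) j = ¬? (i ℕ.≟ k) ×-dec walk? k κ j

walk-++ : ∀ {m n i j l} (κ : Vec ℕ m) {κ′ : Vec ℕ n} → Walk i (κ ++ᵛ j ∷ κ′) l ⇔ (Walk i κ j × Walk j κ′ l)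
walk-++ []      = mk⇔ id id
walk-++ (k ∷ κ) = mk⇔ (λ { (p , q) → let (r , s) = Equivalence.to (walk-++ κ) q in (p , r) , s })
                      (λ { ((p , r) , s) → p , Equivalence.from (walk-++ κ) (r , s) })

-- κ properly colors a path whose last vertex is joined to a further vertex of
-- color l.
Separated : ∀ {n} → Vec ℕ (suc n) → ℕ → Set
Separated {n} κ l = (∀ u v → toℕ v ≡ suc (toℕ u) → lookup κ u ≢ lookup κ v)
                  × (∀ u → suc (toℕ u) ≡ suc n → lookup κ u ≢ l)

walk⇒separated : ∀ {n} i (κ : Vec ℕ n) l → Walk i κ l → Separated (i ∷ κ) l
walk⇒separated i []      l w = (λ { zero zero () }) , λ { zero _ → w }
walk⇒separated i (k ∷ κ) l (i≢k , w) with walk⇒separated k κ l w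
... | path , end =
  (λ { zero (suc zero) _ → i≢k ; (suc u) (suc v) eq → path u v (ℕ.suc-injective eq) }) ,
  (λ { (suc u) eq → end u (ℕ.suc-injective eq) })

separated⇒walk : ∀ {n} i (κ : Vec ℕ n) l → Separated (i ∷ κ) l → Walk i κ l
separated⇒walk i []      l (_ , end)    = end zero ≡.refl
separated⇒walk i (k ∷ κ) l (path , end) = path zero (suc zero) ≡.refl ,
  separated⇒walk k κ l ((λ u v eq → path (suc u) (suc v) (≡.cong suc eq)) , λ u eq → end (suc u) (≡.cong suc eq))

lookup-middle : ∀ {m n} (κ : Vec ℕ m) j (κ′ : Vec ℕ n) v → toℕ v ≡ m → lookup (κ ++ᵛ j ∷ κ′) v ≡ j
lookup-middle []      j κ′ zero    _  = ≡.refl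
lookup-middle (k ∷ κ) j κ′ (suc v) eq = lookup-middle κ j κ′ v (ℕ.suc-injective eq)

-- The edges of the cycle make the colors after i a closed walk from i to i, which splits at the
-- color j of the far end of the chord; the chord itself demands i ≢ j.
proper⇔ : ∀ {a b} i (κ : Vec ℕ a) j (κ′ : Vec ℕ b) →
  Proper (CC (suc a) (suc b)) (i ∷ κ ++ᵛ j ∷ κ′) ⇔ (i ≢ j × Walk i κ j × Walk j κ′ i)
proper⇔ {a} {b} i κ j κ′ = mk⇔ to from
  where
  ρ = i ∷ κ ++ᵛ j ∷ κ′

  middle : Fin (suc a ℕ.+ suc b)
  middle = suc (fromℕ< (ℕ.m<m+n a z<s))

  toℕ-middle : toℕ middle ≡ suc a
  toℕ-middle = ≡.cong suc (Fin.toℕ-fromℕ< (ℕ.m<m+n a z<s))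

  lookup-chord : ∀ v → toℕ v ≡ suc a → lookup ρ v ≡ j
  lookup-chord (suc v) eq = lookup-middle κ j κ′ v (ℕ.suc-injective eq)

  to : Proper (CC (suc a) (suc b)) ρ → i ≢ j × Walk i κ j × Walk j κ′ i
  to proper = (λ i≡j → proper zero middle (inj₁ (inj₂ (inj₂ (≡.refl , toℕ-middle))))
                         (≡.trans i≡j (≡.sym (lookup-chord middle toℕ-middle))))
            , Equivalence.to (walk-++ κ) (separated⇒walk i (κ ++ᵛ j ∷ κ′) i
                ( (λ u v eq → proper u v (inj₁ (inj₁ eq)))
                , (λ u eq → proper u zero (inj₁ (inj₂ (inj₁ (eq , ≡.refl)))))))

  from : i ≢ j × Walk i κ j × Walk j κ′ i → Proper (CC (suc a) (suc b)) ρ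
  from (i≢j , walks) u v = λ { (inj₁ e) → edge u v e ; (inj₂ e) → edge v u e ∘ ≡.sym }
    where
    separated = walk⇒separated i (κ ++ᵛ j ∷ κ′) i (Equivalence.from (walk-++ κ) walks)

    edge : ∀ u v → CycleChord.Edge (suc a) (suc b) u v → lookup ρ u ≢ lookup ρ v
    edge u v    (inj₁ eq)                 = proj₁ separated u v eq
    edge u zero (inj₂ (inj₁ (eq , ≡.refl))) = proj₂ separated u eq
    edge zero v (inj₂ (inj₂ (≡.refl , eq))) = λ i≡ → i≢j (≡.trans i≡ (lookup-chord v eq))

-- Elementary and chromatic symmetric functions as sums over N colors

module Colorings (N : ℕ) where
  open CommutativeRing ring[ N ] hiding (zero)
  open Sums ring[ N ]
  open IntegerSolver ring[ N ]
  open ColorSums ℤ⟦x₁,x₂,…⟧ N public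
  open import Relation.Binary.Reasoning.Setoid setoid

  ∑-monomials≈ : ∀ {n} {P : Unary.Pred (Vec ℕ n) 0ℓ} (P? : Unary.Decidable P) →
    ∑-monomials P? ≈[ N ] ∑ n (λ κ → indicator (does (P? κ)) * weight κ)
  -- The coefficient at α is defined by colorings with `length α` colors; matching identifies this
  -- number with N.
  ∑-monomials≈ {n} P? α ≡.refl = ≡.trans (length-filter-vectors N n _)
    (≡.trans (∑ℤ-cong N n summand) (≡.sym (∑-coefficient N n _ α)))
    where
    summand : ∀ κ → All (_< N) κ →
      (if does (P? κ ×-dec List.≡-dec ℕ._≟_ (exponents N κ) α) then ℤ.1ℤ else ℤ.0ℤ)
        ≡ convolve (indicator (does (P? κ))) (weight κ) α
    summand κ κ<N with does (P? κ)
    ... | true  = ≡.trans (≡.sym (weight≈monomial N κ κ<N α ≡.refl)) (≡.sym (*-identityˡ (weight κ) α ≡.refl))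
    ... | false = ≡.sym (zeroˡ (weight κ) α ≡.refl)

  ∑-cong : ∀ n {g h : Vec ℕ n → Λ} → (∀ κ → g κ ≈ h κ) → ∑ n g ≈ ∑ n h
  ∑-cong zero    g≈h = g≈h []
  ∑-cong (suc n) g≈h = sum-cong-≋ {N} λ i → ∑-cong n λ κ → g≈h (toℕ i ∷ κ)

  ∑-*ˡ : ∀ n r g → ∑ n (λ κ → r * g κ) ≈ r * ∑ n g
  ∑-*ˡ zero    r g = refl
  ∑-*ˡ (suc n) r g = trans (sum-cong-≋ {N} λ i → ∑-*ˡ n r (λ κ → g (toℕ i ∷ κ)))
    (sym (*-distribˡ-sum {N} r (λ i → ∑ n (λ κ → g (toℕ i ∷ κ)))))

  ∑-sum-comm : ∀ n {m} (g : Vec ℕ n → Fin m → Λ) → ∑ n (λ κ → sum (g κ)) ≈ sum (λ j → ∑ n (λ κ → g κ j))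
  ∑-sum-comm zero    g = refl
  ∑-sum-comm (suc n) g = trans (sum-cong-≋ {N} λ i → ∑-sum-comm n (λ κ → g (toℕ i ∷ κ)))
    (∑-comm {N} (λ i j → ∑ n (λ κ → g (toℕ i ∷ κ) j)))

  ∑-++ : ∀ m n g → ∑ (m ℕ.+ n) g ≈ ∑ m (λ κ → ∑ n (λ κ′ → g (κ ++ᵛ κ′)))
  ∑-++ zero    n g = refl
  ∑-++ (suc m) n g = sum-cong-≋ {N} λ i → ∑-++ m n (λ κ → g (toℕ i ∷ κ))

  weight-++ : ∀ {m n} (κ : Vec ℕ m) (κ′ : Vec ℕ n) → weight (κ ++ᵛ κ′) ≈ weight κ * weight κ′
  weight-++ []      κ′ = sym (*-identityˡ (weight κ′))
  weight-++ (i ∷ κ) κ′ = trans (*-congˡ {var i} (weight-++ κ κ′)) (sym (*-assoc (var i) (weight κ) (weight κ′)))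

  ∑-indicator : ∀ n b (c : Vec ℕ n → Bool) i →
    ∑ n (λ κ → indicator (b ∧ c κ) * weight (i ∷ κ))
      ≈ indicator b * (var i * ∑ n (λ κ → indicator (c κ) * weight κ))
  ∑-indicator n b c i = begin
    ∑ n (λ κ → indicator (b ∧ c κ) * weight (i ∷ κ))
      ≈⟨ ∑-cong n (λ κ → trans (*-congʳ {var i * weight κ} (indicator-∧ b (c κ)))
           (solve 4 (λ b c x w → b :* c :* (x :* w) := (b :* x) :* (c :* w)) refl (indicator b) (indicator (c κ)) (var i) (weight κ))) ⟩
    ∑ n (λ κ → indicator b * var i * (indicator (c κ) * weight κ))
      ≈⟨ ∑-*ˡ n (indicator b * var i) _ ⟩
    indicator b * var i * ∑ n (λ κ → indicator (c κ) * weight κ)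
      ≈⟨ *-assoc (indicator b) (var i) _ ⟩
    indicator b * (var i * ∑ n (λ κ → indicator (c κ) * weight κ)) ∎

  increasing : ℕ → ℕ → Λ
  increasing m n = ∑ n (λ κ → indicator (does (increasingFrom? m κ)) * weight κ)

  e≈increasing : ∀ n → e n ≈ increasing 0 n
  e≈increasing n = trans (∑-monomials≈ {n} (linked? ℕ._<?_)) (∑-cong n same)
    where
    same : ∀ (κ : Vec ℕ n) → indicator (does (linked? ℕ._<?_ κ)) * weight κ
                           ≈ indicator (does (increasingFrom? 0 κ)) * weight κ
    same κ = reflexive (≡.cong (λ b → indicator b * weight κ)
      (does-⇔ (linked⇔increasing κ) (linked? ℕ._<?_ κ) (increasingFrom? 0 κ)))

  indicator-≤ : ∀ m i → indicator (m ≤ᵇ i) ≈ indicator (m ≡ᵇ i) + indicator (m <ᵇ i)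
  indicator-≤ zero    zero    = sym (+-identityʳ 1#)
  indicator-≤ zero    (suc i) = sym (+-identityˡ 1#)
  indicator-≤ (suc m) zero    = sym (+-identityˡ 0#)
  indicator-≤ (suc m) (suc i) = trans (reflexive (≡.cong indicator (<ᵇ-suc m))) (indicator-≤ m i)
    where
    <ᵇ-suc : ∀ m → (m <ᵇ suc i) ≡ (m ≤ᵇ i)
    <ᵇ-suc zero    = ≡.refl
    <ᵇ-suc (suc m) = ≡.refl

  increasing-suc : ∀ m n → increasing m (suc n)
    ≈ sum {N} (λ i → indicator (m ≤ᵇ toℕ i) * (var (toℕ i) * increasing (suc (toℕ i)) n))
  increasing-suc m n = sum-cong-≋ {N} λ i →
    ∑-indicator n (m ≤ᵇ toℕ i) (λ κ → does (increasingFrom? (suc (toℕ i)) κ)) (toℕ i)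

  -- If the color m occurs in an increasing sequence with entries at least m, then it comes first.
  -- This is the recursion for the coefficients of a product with the further factor 1 + z `var m`.
  increasing-< : ∀ {m} n → m < N → increasing m (suc n) ≈ increasing (suc m) (suc n) + var m * increasing (suc m) n
  increasing-< {m} n m<N = begin
    increasing m (suc n)    ≈⟨ increasing-suc m n ⟩
    sum {N} (λ i → indicator (m ≤ᵇ toℕ i) * t (toℕ i))
      ≈⟨ sum-cong-≋ {N} (λ i → trans (*-congʳ {t (toℕ i)} (indicator-≤ m (toℕ i))) (distribʳ (t (toℕ i)) _ _)) ⟩
    sum {N} (λ i → indicator (m ≡ᵇ toℕ i) * t (toℕ i) + indicator (m <ᵇ toℕ i) * t (toℕ i))
      ≈⟨ ∑-distrib-+ {N} (λ i → indicator (m ≡ᵇ toℕ i) * t (toℕ i)) _ ⟩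
    sum {N} (λ i → indicator (m ≡ᵇ toℕ i) * t (toℕ i)) + sum {N} (λ i → indicator (m <ᵇ toℕ i) * t (toℕ i))
      ≈⟨ +-cong pick (sym (increasing-suc (suc m) n)) ⟩
    t m + increasing (suc m) (suc n)
      ≈⟨ +-comm (t m) _ ⟩
    increasing (suc m) (suc n) + t m ∎
    where
    t : ℕ → Λ
    t i = var i * increasing (suc i) n

    pick : sum {N} (λ i → indicator (m ≡ᵇ toℕ i) * t (toℕ i)) ≈ t m
    pick = ≡.subst (λ m → sum {N} (λ i → indicator (m ≡ᵇ toℕ i) * t (toℕ i)) ≈ t m)
      (Fin.toℕ-fromℕ< m<N) (sum-δ (fromℕ< m<N) (t ∘ toℕ))

  increasing-N : ∀ n → increasing N (suc n) ≈ 0#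
  increasing-N n = trans (increasing-suc N n) (sum-zero {N} λ i →
    trans (*-congʳ {var (toℕ i) * increasing (suc (toℕ i)) n}
      (reflexive (≡.cong indicator (does-⇔ (mk⇔ (λ N≤i → contradiction N≤i (ℕ.<⇒≱ (Fin.toℕ<n i))) λ ()) (N ℕ.≤? toℕ i) (no id)))))
      (zeroˡ _))

  walks : ℕ → ℕ → ℕ → Λ
  walks n i j = ∑ n (λ κ → indicator (does (walk? i κ j)) * weight κ)

  walks-zero : ∀ i j → walks 0 i j ≈ indicator (not (i ≡ᵇ j))
  walks-zero i j = *-identityʳ _

  walks-suc : ∀ n i j → walks (suc n) i j
    ≈ sum {N} (λ k → indicator (not (i ≡ᵇ toℕ k)) * (var (toℕ k) * walks n (toℕ k) j))
  walks-suc n i j = sum-cong-≋ {N} λ k →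
    ∑-indicator n (not (i ≡ᵇ toℕ k)) (λ κ → does (walk? (toℕ k) κ j)) (toℕ k)

  -- Once the colors i and j of the two ends of the chord are fixed, the arcs are colored
  -- independently.
  X-CC≈ : ∀ a b → X (CC (suc a) (suc b)) ≈ sum {N} (λ i → sum {N} (λ j →
    indicator (not (toℕ i ≡ᵇ toℕ j))
      * ((var (toℕ i) * walks a (toℕ i) (toℕ j)) * (var (toℕ j) * walks b (toℕ j) (toℕ i)))))
  X-CC≈ a b = begin
    X (CC (suc a) (suc b))
      ≈⟨ ∑-monomials≈ (proper? (CC (suc a) (suc b))) ⟩
    sum {N} (λ i → ∑ (a ℕ.+ suc b) (λ ρ → term (toℕ i ∷ ρ)))
      -- In the order of the vertices, j comes only after the a interior colors of the first arc;
      -- its sum is moved outwards past theirs.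
      ≈⟨ sum-cong-≋ {N} (λ i → trans (∑-++ a (suc b) (λ ρ → term (toℕ i ∷ ρ)))
           (∑-sum-comm a {N} (λ κ j → ∑ b (λ κ′ → term (toℕ i ∷ κ ++ᵛ toℕ j ∷ κ′))))) ⟩
    sum {N} (λ i → sum {N} (λ j → ∑ a (λ κ → ∑ b (λ κ′ → term (toℕ i ∷ κ ++ᵛ toℕ j ∷ κ′)))))
      ≈⟨ sum-cong-≋ {N} (λ i → sum-cong-≋ {N} (λ j → factor (toℕ i) (toℕ j))) ⟩
    sum {N} (λ i → sum {N} (λ j → indicator (not (toℕ i ≡ᵇ toℕ j))
      * ((var (toℕ i) * walks a (toℕ i) (toℕ j)) * (var (toℕ j) * walks b (toℕ j) (toℕ i))))) ∎
    where
    term : Vec ℕ (suc a ℕ.+ suc b) → Λ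
    term ρ = indicator (does (proper? (CC (suc a) (suc b)) ρ)) * weight ρ

    term≈ : ∀ i κ j κ′ → term (i ∷ κ ++ᵛ j ∷ κ′)
      ≈ (indicator (not (i ≡ᵇ j)) * (var i * var j) * (indicator (does (walk? i κ j)) * weight κ))
          * (indicator (does (walk? j κ′ i)) * weight κ′)
    term≈ i κ j κ′ = begin
      term (i ∷ κ ++ᵛ j ∷ κ′)
        ≈⟨ *-cong {indicator (does (proper? (CC (suc a) (suc b)) (i ∷ κ ++ᵛ j ∷ κ′)))}
                  (reflexive (≡.cong indicator (does-⇔ (proper⇔ i κ j κ′)
                    (proper? (CC (suc a) (suc b)) (i ∷ κ ++ᵛ j ∷ κ′))
                    (¬? (i ℕ.≟ j) ×-dec (walk? i κ j ×-dec walk? j κ′ i)))))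
                  (*-congˡ {var i} (weight-++ κ (j ∷ κ′))) ⟩
      indicator (not (i ≡ᵇ j) ∧ (does (walk? i κ j) ∧ does (walk? j κ′ i))) * (var i * (weight κ * (var j * weight κ′)))
        ≈⟨ *-congʳ {var i * (weight κ * (var j * weight κ′))} (trans (indicator-∧ (not (i ≡ᵇ j)) _)
             (*-congˡ {indicator (not (i ≡ᵇ j))} (indicator-∧ (does (walk? i κ j)) (does (walk? j κ′ i))))) ⟩
      indicator (not (i ≡ᵇ j)) * (indicator (does (walk? i κ j)) * indicator (does (walk? j κ′ i)))
        * (var i * (weight κ * (var j * weight κ′)))
        ≈⟨ solve 7 (λ c p q x w y v → c :* (p :* q) :* (x :* (w :* (y :* v))) := (c :* (x :* y) :* (p :* w)) :* (q :* v)) refl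
             (indicator (not (i ≡ᵇ j))) (indicator (does (walk? i κ j))) (indicator (does (walk? j κ′ i)))
             (var i) (weight κ) (var j) (weight κ′) ⟩
      _ ∎

    factor : ∀ i j → ∑ a (λ κ → ∑ b (λ κ′ → term (i ∷ κ ++ᵛ j ∷ κ′)))
      ≈ indicator (not (i ≡ᵇ j)) * ((var i * walks a i j) * (var j * walks b j i))
    factor i j = begin
      ∑ a (λ κ → ∑ b (λ κ′ → term (i ∷ κ ++ᵛ j ∷ κ′)))
        ≈⟨ ∑-cong a (λ κ → trans (∑-cong b (λ κ′ → term≈ i κ j κ′)) (trans (∑-*ˡ b (c * (indicator (does (walk? i κ j)) * weight κ)) _)
             (trans (*-comm (c * (indicator (does (walk? i κ j)) * weight κ)) (walks b j i))
               (sym (*-assoc (walks b j i) c (indicator (does (walk? i κ j)) * weight κ)))))) ⟩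
      ∑ a (λ κ → (walks b j i * c) * (indicator (does (walk? i κ j)) * weight κ))
        ≈⟨ ∑-*ˡ a (walks b j i * c) _ ⟩
      (walks b j i * c) * walks a i j
        ≈⟨ solve 5 (λ q c x y p → q :* (c :* (x :* y)) :* p := c :* ((x :* p) :* (y :* q))) refl
             (walks b j i) (indicator (not (i ≡ᵇ j))) (var i) (var j) (walks a i j) ⟩
      indicator (not (i ≡ᵇ j)) * ((var i * walks a i j) * (var j * walks b j i)) ∎
      where c = indicator (not (i ≡ᵇ j)) * (var i * var j)

-- Homomorphisms applied to the coefficients of a series

module MapCoefficients {a b ℓ₁ ℓ₂ ℓ₃ ℓ₄}
  (R : RawRing a ℓ₁) (_~ᴿ_ : Rel (RawRing.Carrier R) ℓ₂) (R-ring : IsCommutativeRingUnder R _~ᴿ_)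
  (S : RawRing b ℓ₃) (_~ˢ_ : Rel (RawRing.Carrier S) ℓ₄) (S-ring : IsCommutativeRingUnder S _~ˢ_)
  where
  private
    module R = SeriesProperties R _~ᴿ_ R-ring
    module S = SeriesProperties S _~ˢ_ S-ring
  open CommutativeRing S.coefficientRing hiding (zero)

  module _ {h} (homomorphism : IsRingHomomorphism (CommutativeRing.rawRing R.coefficientRing)
                                 (CommutativeRing.rawRing S.coefficientRing) h) where
    open IsRingHomomorphism homomorphism

    map-* : ∀ f g n → h ((f R.*ˢ g) n) ≈ ((h ∘ f) S.*ˢ (h ∘ g)) n
    map-* f g zero    = trans (+-homo _ _) (+-cong (*-homo (f 0) (g 0)) 0#-homo)
    map-* f g (suc n) = trans (+-homo _ _) (+-cong (*-homo (f 0) (g (suc n))) (map-* (f ∘ suc) g n))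

    map-isRingHomomorphism :
      IsRingHomomorphism (CommutativeRing.rawRing R.seriesRing) (CommutativeRing.rawRing S.seriesRing) (h ∘_)
    map-isRingHomomorphism = isRingHomomorphism record
      { cong   = λ p n → ⟦⟧-cong (p n)
      ; +-homo = λ f g n → +-homo (f n) (g n)
      ; *-homo = map-*
      ; -‿homo = λ f n → -‿homo (f n)
      ; 0-homo = λ n → 0#-homo
      ; 1-homo = λ { zero → 1#-homo ; (suc n) → 0#-homo }
      }

-- Derivatives of a product of linear factors

module LinearProduct {c ℓ₀ ℓ} (R : RawRing c ℓ₀) (_~_ : Rel (RawRing.Carrier R) ℓ)
  (isCommutativeRing : IsCommutativeRingUnder R _~_) where
  open SeriesProperties R _~_ isCommutativeRing
  open CommutativeRing seriesRing hiding (zero)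
  open Sums seriesRing
  open IntegerSolver seriesRing
  open import Relation.Binary.Reasoning.Setoid setoid

  linear : RawRing.Carrier R → Series
  linear r = 1# + indeterminate * constant r

  linearProduct : ∀ {n} → (Fin n → RawRing.Carrier R) → Series
  linearProduct {zero}  r = 1#
  linearProduct {suc n} r = linear (r zero) * linearProduct (r ∘ suc)

  module _ {n} (r : Fin n → RawRing.Carrier R) (d : Fin n → Series) where
    u : Fin n → Series
    u i = constant (r i) * d i

    s s₂ : Series
    s  = sum u
    s₂ = sum (λ i → u i * u i)

  -- The derivative of a linear factor becomes a multiple of that factor, so logarithmic derivatives
  -- can be used without dividing.
  linear-u : ∀ r d → d * linear r ≈ 1# → constant r ≈ linear r * (constant r * d)
  linear-u r d d-inverse = begin
    constant r                        ≈⟨ *-identityʳ (constant r) ⟨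
    constant r * 1#                   ≈⟨ *-congˡ {constant r} d-inverse ⟨
    constant r * (d * linear r)       ≈⟨ solve 3 (λ r d l → r :* (d :* l) := l :* (r :* d)) refl (constant r) d (linear r) ⟩
    linear r * (constant r * d)       ∎

  linearProduct-′ : ∀ {n} (r : Fin n → RawRing.Carrier R) d → (∀ i → d i * linear (r i) ≈ 1#) →
    linearProduct r ′ ≈ linearProduct r * s r d
  linearProduct-′ {zero}  r d d-inverse = trans 1′≈0 (sym (zeroʳ 1#))
    where
    1′≈0 : 1# ′ ≈ 0#
    1′≈0 n = ·-zero (suc n)
  linearProduct-′ {suc n} r d d-inverse = begin
    (l * p) ′                       ≈⟨ ′-linear-* (r zero) p ⟩
    l * p ′ + constant (r zero) * p
      ≈⟨ +-cong (*-congˡ {l} (linearProduct-′ (r ∘ suc) (d ∘ suc) (d-inverse ∘ suc)))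
                (*-congʳ {p} (linear-u (r zero) (d zero) (d-inverse zero))) ⟩
    l * (p * s′) + (l * u₀) * p
      ≈⟨ solve 4 (λ l p s u → l :* (p :* s) :+ (l :* u) :* p := (l :* p) :* (u :+ s)) refl l p s′ u₀ ⟩
    (l * p) * (u₀ + s′)             ∎
    where
    l  = linear (r zero)
    p  = linearProduct (r ∘ suc)
    u₀ = constant (r zero) * d zero
    s′ = s (r ∘ suc) (d ∘ suc)

  -- Two different factors are differentiated, since the second derivative of a linear factor is
  -- zero; the bracket is the sum of uᵢ uⱼ over ordered pairs i ≠ j.
  linearProduct-″ : ∀ {n} (r : Fin n → RawRing.Carrier R) d → (∀ i → d i * linear (r i) ≈ 1#) →
    linearProduct r ′ ′ ≈ linearProduct r * (s r d * s r d - s₂ r d)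
  linearProduct-″ {zero}  r d d-inverse = trans 1″≈0
    (solve 0 (con (0 , 0) := con (1 , 0) :* (con (0 , 0) :* con (0 , 0) :- con (0 , 0))) refl)
    where
    1″≈0 : 1# ′ ′ ≈ 0#
    1″≈0 n = CommutativeRing.trans coefficientRing (·-cong (suc n) (·-zero (suc (suc n)))) (·-zero (suc n))
  linearProduct-″ {suc n} r d d-inverse = begin
    (l * p) ′ ′                                       ≈⟨ ′-cong (′-linear-* (r zero) p) ⟩
    (l * p ′ + constant (r zero) * p) ′               ≈⟨ ′-+ (l * p ′) (constant (r zero) * p) ⟩
    (l * p ′) ′ + (constant (r zero) * p) ′
      ≈⟨ +-cong (′-linear-* (r zero) (p ′)) (′-constant-* (r zero) p) ⟩
    (l * p ′ ′ + constant (r zero) * p ′) + constant (r zero) * p ′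
      ≈⟨ +-cong (+-cong (*-congˡ {l} (linearProduct-″ (r ∘ suc) (d ∘ suc) (d-inverse ∘ suc))) term) term ⟩
    (l * (p * (s′ * s′ - s₂′)) + (l * u₀) * (p * s′)) + (l * u₀) * (p * s′)
      ≈⟨ solve 5 (λ l p s t u → (l :* (p :* (s :* s :- t)) :+ (l :* u) :* (p :* s)) :+ (l :* u) :* (p :* s)
           := (l :* p) :* ((u :+ s) :* (u :+ s) :- (u :* u :+ t))) refl l p s′ s₂′ u₀ ⟩
    (l * p) * ((u₀ + s′) * (u₀ + s′) - (u₀ * u₀ + s₂′)) ∎
    where
    l   = linear (r zero)
    p   = linearProduct (r ∘ suc)
    u₀  = constant (r zero) * d zero
    s′  = s (r ∘ suc) (d ∘ suc)
    s₂′ = s₂ (r ∘ suc) (d ∘ suc)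

    term : constant (r zero) * p ′ ≈ (l * u₀) * (p * s′)
    term = *-cong (linear-u (r zero) (d zero) (d-inverse zero))
                  (linearProduct-′ (r ∘ suc) (d ∘ suc) (d-inverse ∘ suc))

-- Coefficients of sums, and transport of relations along homomorphisms

module SeriesSums {c ℓ₀ ℓ} (R : RawRing c ℓ₀) (_~_ : Rel (RawRing.Carrier R) ℓ)
  (isCommutativeRing : IsCommutativeRingUnder R _~_) where
  open SeriesProperties R _~_ isCommutativeRing
  open CommutativeRing coefficientRing hiding (zero)
  open Sums coefficientRing using (sum; indicator)
  open Sums seriesRing using () renaming (sum to sumˢ; indicator to indicatorˢ)

  sum-coefficient : ∀ {n} (s : Fin n → Series) k → sumˢ s k ≡ sum (λ i → s i k)
  sum-coefficient {zero}  s k = ≡.refl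
  sum-coefficient {suc n} s k = ≡.cong (_+_ (s zero k)) (sum-coefficient (s ∘ suc) k)

  indicator-coefficient : ∀ b f k → (indicatorˢ b *ˢ f) k ≈ indicator b * f k
  indicator-coefficient true  f k = constant-* 1# f k
  indicator-coefficient false f k = trans (*ˢ-zeroˡ f k) (sym (zeroˡ (f k)))

-- The facts about walks hold for series in z, the final identity for series in x and y. Every
-- hypothesis of the latter is the image of such a fact under one of the two substitutions.
module Image {a b ℓ₁ ℓ₂} (A : CommutativeRing a ℓ₁) (B : CommutativeRing b ℓ₂) {⟦_⟧}
  (homomorphism : IsRingHomomorphism (CommutativeRing.rawRing A) (CommutativeRing.rawRing B) ⟦_⟧) where
  private
    module A = CommutativeRing A
    open Sums A using () renaming (sum to sumᴬ)
  open CommutativeRing B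
  open Sums B using (sum; sum-cong-≋)
  open IsRingHomomorphism homomorphism
  open import Relation.Binary.Reasoning.Setoid setoid

  sum-homo : ∀ {n} (s : Fin n → A.Carrier) → ⟦ sumᴬ s ⟧ ≈ sum (λ i → ⟦ s i ⟧)
  sum-homo {ℕ.zero}  s = 0#-homo
  sum-homo {ℕ.suc n} s = trans (+-homo _ _) (+-congˡ (sum-homo (s ∘ suc)))

  -‿+-homo : ∀ p q → ⟦ p A.- q ⟧ ≈ ⟦ p ⟧ - ⟦ q ⟧
  -‿+-homo p q = trans (+-homo p _) (+-congˡ (-‿homo q))

  module Generators {N} (z : A.Carrier) (r : Fin N → A.Carrier) (w : Carrier) (X : Fin N → Carrier)
    (z-image : ⟦ z ⟧ ≈ w) (r-image : ∀ i → ⟦ r i ⟧ ≈ X i) where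

    inverse-image : ∀ d i → d A.* (A.1# A.+ z A.* r i) A.≈ A.1# → ⟦ d ⟧ * (1# + w * X i) ≈ 1#
    inverse-image d i d-inverse = begin
      ⟦ d ⟧ * (1# + w * X i)
        ≈⟨ *-congˡ (+-cong 1#-homo (trans (*-homo z (r i)) (*-cong z-image (r-image i)))) ⟨
      ⟦ d ⟧ * (⟦ A.1# ⟧ + ⟦ z A.* r i ⟧)    ≈⟨ *-congˡ (+-homo A.1# (z A.* r i)) ⟨
      ⟦ d ⟧ * ⟦ A.1# A.+ z A.* r i ⟧        ≈⟨ *-homo d _ ⟨
      ⟦ d A.* (A.1# A.+ z A.* r i) ⟧        ≈⟨ ⟦⟧-cong d-inverse ⟩
      ⟦ A.1# ⟧                              ≈⟨ 1#-homo ⟩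
      1#                                    ∎

    -z*-image : ∀ E E′ F → F A.≈ E A.- z A.* E′ → ⟦ F ⟧ ≈ ⟦ E ⟧ - w * ⟦ E′ ⟧
    -z*-image E E′ F F≈ = trans (⟦⟧-cong F≈) (trans (-‿+-homo E _)
      (+-congˡ (-‿cong (trans (*-homo z E′) (*-congʳ z-image)))))

    module _ (d : Fin N → A.Carrier) where
      u-image : ∀ i → ⟦ r i A.* d i ⟧ ≈ X i * ⟦ d i ⟧
      u-image i = trans (*-homo (r i) (d i)) (*-congʳ (r-image i))

      s-image : ⟦ sumᴬ (λ i → r i A.* d i) ⟧ ≈ sum (λ i → X i * ⟦ d i ⟧)
      s-image = trans (sum-homo (λ i → r i A.* d i)) (sum-cong-≋ u-image)

      *-s-image : ∀ E E′ → E′ A.≈ E A.* sumᴬ (λ i → r i A.* d i) →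
        ⟦ E′ ⟧ ≈ ⟦ E ⟧ * sum (λ i → X i * ⟦ d i ⟧)
      *-s-image E E′ E′≈ = trans (⟦⟧-cong E′≈) (trans (*-homo E _) (*-congˡ s-image))

      *-s²-s₂-image : ∀ E E″ →
        E″ A.≈ E A.* (sumᴬ (λ i → r i A.* d i) A.* sumᴬ (λ i → r i A.* d i)
                      A.- sumᴬ (λ i → (r i A.* d i) A.* (r i A.* d i))) →
        ⟦ E″ ⟧ ≈ ⟦ E ⟧ * (sum (λ i → X i * ⟦ d i ⟧) * sum (λ i → X i * ⟦ d i ⟧)
                          - sum (λ i → (X i * ⟦ d i ⟧) * (X i * ⟦ d i ⟧)))
      *-s²-s₂-image E E″ E″≈ = trans (⟦⟧-cong E″≈) (trans (*-homo E _) (*-congˡ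
        (trans (-‿+-homo _ _) (+-cong (trans (*-homo _ _) (*-cong s-image s-image))
          (-‿cong (trans (sum-homo (λ i → (r i A.* d i) A.* (r i A.* d i)))
            (sum-cong-≋ λ i → trans (*-homo _ _) (*-cong (u-image i) (u-image i)))))))))

  *-1-image : ∀ F G → F A.* G A.≈ A.1# → ⟦ F ⟧ * ⟦ G ⟧ ≈ 1#
  *-1-image F G F*G≈1 = trans (sym (*-homo F G)) (trans (⟦⟧-cong F*G≈1) 1#-homo)

  quotient-image : ∀ p F G E d d′ → F A.* G A.≈ A.1# → p A.* F A.≈ E A.* (d A.* d′) →
    ⟦ p ⟧ ≈ ⟦ E ⟧ * (⟦ d ⟧ * ⟦ d′ ⟧) * ⟦ G ⟧
  quotient-image p F G E d d′ F*G≈1 p*F≈ = begin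
    ⟦ p ⟧                                ≈⟨ ⟦⟧-cong (A.trans (A.sym (A.*-identityʳ p)) (A.trans (A.*-congˡ (A.sym F*G≈1))
                                              (A.trans (A.sym (A.*-assoc p F G)) (A.*-congʳ p*F≈)))) ⟩
    ⟦ E A.* (d A.* d′) A.* G ⟧           ≈⟨ trans (*-homo _ G) (*-congʳ (trans (*-homo E _) (*-congˡ (*-homo d d′)))) ⟩
    ⟦ E ⟧ * (⟦ d ⟧ * ⟦ d′ ⟧) * ⟦ G ⟧     ∎

-- Generating functions in z

module GeneratingFunctions (N : ℕ) where
  open Colorings N
  open SeriesProperties ℤ⟦x₁,x₂,…⟧ _≈[ N ]_ isCommutativeRing[ N ]
  open SeriesSums ℤ⟦x₁,x₂,…⟧ _≈[ N ]_ isCommutativeRing[ N ]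
  open LinearProduct ℤ⟦x₁,x₂,…⟧ _≈[ N ]_ isCommutativeRing[ N ]
  open CommutativeRing seriesRing hiding (zero)
  open Sums seriesRing
  private
    module Λ = CommutativeRing ring[ N ]
    module Λ-Sums = Sums ring[ N ]

  -- Induction on the number k of colors from m on: `increasing-<` and `linear-*` are the same
  -- recursion. The factors `h` are only tied to `var` by an equation, since `m + suc i` and
  -- `suc m + i` do not coincide by computation.
  increasing-linearProduct : ∀ {k} m (h : Fin k → Λ) → m ℕ.+ k ≡ N → (∀ i → h i ≡ var (m ℕ.+ toℕ i)) →
    ∀ n → increasing m n Λ.≈ linearProduct h n
  increasing-linearProduct {zero}  m h m+k≡N h≡ zero    = Λ.*-identityʳ Λ.1#
  increasing-linearProduct {zero}  m h m+k≡N h≡ (suc n) =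
    ≡.subst (λ m → increasing m (suc n) Λ.≈ Λ.0#) (≡.trans (≡.sym m+k≡N) (ℕ.+-identityʳ m)) (increasing-N n)
  increasing-linearProduct {suc k} m h m+k≡N h≡ = coefficient
    where
    rest : ∀ n → increasing (suc m) n Λ.≈ linearProduct (h ∘ suc) n
    rest = increasing-linearProduct (suc m) (h ∘ suc) (≡.trans (≡.sym (ℕ.+-suc m k)) m+k≡N)
      λ i → ≡.trans (h≡ (suc i)) (≡.cong var (ℕ.+-suc m (toℕ i)))

    h₀≡ : h zero ≡ var m
    h₀≡ = ≡.trans (h≡ zero) (≡.cong var (ℕ.+-identityʳ m))

    m<N : m ℕ.< N
    m<N = ≡.subst (m ℕ.<_) m+k≡N (ℕ.m<m+n m ℕ.z<s)

    coefficient : ∀ n → increasing m n Λ.≈ linearProduct h n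
    coefficient zero    = Λ.trans (rest zero) (Λ.sym (linear-*₀ (h zero) (linearProduct (h ∘ suc))))
    coefficient (suc n) = Λ.trans (increasing-< n m<N)
      (Λ.trans (Λ.+-cong (rest (suc n)) (Λ.*-cong {var m} (Λ.reflexive (≡.sym h₀≡)) (rest n)))
               (Λ.sym (linear-* (h zero) (linearProduct (h ∘ suc)) n)))

  r : Fin N → Λ
  r i = var (toℕ i)

  d : Fin N → Λ⟦z⟧
  d i = linear (r i) ⁻¹

  d-inverse : ∀ i → d i * linear (r i) ≈ 1#
  d-inverse i = trans (*-comm (d i) (linear (r i))) (⁻¹-inverseʳ (linear (r i))
    (Λ.trans (Λ.+-congˡ {Λ.1#} (indeterminate-*₀ (constant (r i)))) (Λ.+-identityʳ Λ.1#)))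

  E≈ : E ≈ linearProduct r
  E≈ n = Λ.trans (e≈increasing n) (increasing-linearProduct 0 r ≡.refl (λ _ → ≡.refl) n)

  E′≈ : E ′ ≈ E * s r d
  E′≈ = trans (′-cong E≈) (trans (linearProduct-′ r d d-inverse) (*-congʳ {s r d} (sym E≈)))

  E″≈ : E ′ ′ ≈ E * (s r d * s r d - s₂ r d)
  E″≈ = trans (′-cong (′-cong E≈)) (trans (linearProduct-″ r d d-inverse) (*-congʳ {s r d * s r d - s₂ r d} (sym E≈)))

  F₀≈1 : F 0 Λ.≈ Λ.1#
  F₀≈1 = Λ.trans (Λ.+-cong (Λ.trans (e≈increasing 0) (Λ.*-identityʳ Λ.1#)) (Λ.-‿cong (indeterminate-*₀ (E ′))))
    (solve 0 (con (1 , 0) :- con (0 , 0) := con (1 , 0)) Λ.refl)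
    where open IntegerSolver ring[ N ]

  F*F⁻¹≈1 : F * F ⁻¹ ≈ 1#
  F*F⁻¹≈1 = ⁻¹-inverseʳ F F₀≈1

  p : Fin N → Fin N → Λ⟦z⟧
  p i j n = walks n (toℕ i) (toℕ j)

  step : Fin N → Fin N → Fin N → Λ⟦z⟧
  step j i k = indicator (not (toℕ i ≡ᵇ toℕ k)) * (constant (r k) * p k j)

  step-coefficient : ∀ j i n → sum (step j i) n
    Λ.≈ Λ-Sums.sum {N} (λ k → Λ-Sums.indicator (not (toℕ i ≡ᵇ toℕ k)) Λ.* (r k Λ.* p k j n))
  step-coefficient j i n = Λ.trans (Λ.reflexive (sum-coefficient (step j i) n))
    (Λ-Sums.sum-cong-≋ {N} λ k → Λ.trans
      (indicator-coefficient (not (toℕ i ≡ᵇ toℕ k)) (constant (r k) * p k j) n)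
      (Λ.*-congˡ {Λ-Sums.indicator (not (toℕ i ≡ᵇ toℕ k))} (constant-* (r k) (p k j) n)))

  p-step : ∀ j i → p i j ≈ indicator (not (toℕ i ≡ᵇ toℕ j)) + indeterminate * sum (step j i)
  p-step j i zero    = Λ.trans (walks-zero (toℕ i) (toℕ j)) (Λ.trans (Λ.sym (Λ.+-identityʳ _))
    (Λ.+-cong (indicator₀ (not (toℕ i ≡ᵇ toℕ j))) (Λ.sym (indeterminate-*₀ (sum (step j i))))))
    where
    indicator₀ : ∀ b → Λ-Sums.indicator b Λ.≈ indicator b 0
    indicator₀ true  = Λ.refl
    indicator₀ false = Λ.refl
  p-step j i (suc n) = Λ.trans (walks-suc n (toℕ i) (toℕ j))
    (Λ.trans (Λ.sym (Λ.+-identityˡ _)) (Λ.+-cong (indicator₊ (not (toℕ i ≡ᵇ toℕ j)))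
      (Λ.trans (Λ.sym (step-coefficient j i n)) (Λ.sym (indeterminate-* (sum (step j i)) n)))))
    where
    indicator₊ : ∀ b → Λ.0# Λ.≈ indicator b (suc n)
    indicator₊ true  = Λ.refl
    indicator₊ false = Λ.refl

  p*F≈ : ∀ i j → (toℕ i ≡ᵇ toℕ j) ≡ false → p i j * F ≈ E * (d i * d j)
  p*F≈ i j = Resolvent.OffDiagonal.off-diagonal seriesRing indeterminate E (E ′) F (constant ∘ r) d
    d-inverse E′≈ refl j (λ i → p i j) (p-step j) i

-- Series in x and y, and the conclusion

module TwoVariables (N : ℕ) where
  open GeneratingFunctions N
  private
    module Z = SeriesProperties ℤ⟦x₁,x₂,…⟧ _≈[ N ]_ isCommutativeRing[ N ]
    module Λ = CommutativeRing ring[ N ]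
    module Λ-Sums = Sums ring[ N ]
    module Z-Sums = SeriesSums ℤ⟦x₁,x₂,…⟧ _≈[ N ]_ isCommutativeRing[ N ]
  open Z using (_′; _⁻¹)
  open SeriesProperties Z.rawRingˢ Z._≈ˢ_ Z.isCommutativeRingˢ
    using (constant-*; constant-isRingHomomorphism; indeterminate-*₀; indeterminate-*)
  open SeriesProperties Z.rawRingˢ Z._≈ˢ_ Z.isCommutativeRingˢ public using (seriesRing)
  open SeriesSums Z.rawRingˢ Z._≈ˢ_ Z.isCommutativeRingˢ
  open CommutativeRing seriesRing hiding (zero)
  open Sums seriesRing

  ⟨x⟩-isRingHomomorphism : IsRingHomomorphism (CommutativeRing.rawRing Z.seriesRing) (CommutativeRing.rawRing seriesRing) _⟨x⟩
  ⟨x⟩-isRingHomomorphism = MapCoefficients.map-isRingHomomorphism ℤ⟦x₁,x₂,…⟧ _≈[ N ]_ isCommutativeRing[ N ]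
    Z.rawRingˢ Z._≈ˢ_ Z.isCommutativeRingˢ Z.constant-isRingHomomorphism

  Xᵢ : Fin N → Λ⟦x,y⟧
  Xᵢ i = Z.constant (r i) ⟨y⟩

  z⟨x⟩≈x : Z.indeterminate ⟨x⟩ ≈ x
  z⟨x⟩≈x 0             = IsRingHomomorphism.0#-homo Z.constant-isRingHomomorphism
  z⟨x⟩≈x 1             = λ n → Λ.refl
  z⟨x⟩≈x (suc (suc a)) = IsRingHomomorphism.0#-homo Z.constant-isRingHomomorphism

  -- Both substitutions fix the coefficients, so the walks along the two arcs share the weights
  -- `Xᵢ`.
  constant⟨x⟩≈constant⟨y⟩ : ∀ c → Z.constant c ⟨x⟩ ≈ Z.constant c ⟨y⟩
  constant⟨x⟩≈constant⟨y⟩ c zero    = λ n → Λ.refl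
  constant⟨x⟩≈constant⟨y⟩ c (suc a) = IsRingHomomorphism.0#-homo Z.constant-isRingHomomorphism

  -- Each indeterminate occurs in one factor only, so the lengths of the two arcs are recorded
  -- separately.
  ⟨x⟩*⟨y⟩-coefficient : ∀ f g a b → (f ⟨x⟩ * g ⟨y⟩) a b Λ.≈ f a Λ.* g b
  ⟨x⟩*⟨y⟩-coefficient f g a b = Λ.trans (*-comm (f ⟨x⟩) (g ⟨y⟩) a b)
    (Λ.trans (constant-* g (f ⟨x⟩) a b) (Λ.trans (Z.*ˢ-comm g (Z.constant (f a)) b) (Z.constant-* (f a) g b)))

  D : Λ⟦x,y⟧
  D = sum {N} (λ i → sum {N} (λ j → indicator (not (toℕ i ≡ᵇ toℕ j)) * ((Xᵢ i * p i j ⟨x⟩) * (Xᵢ j * p j i ⟨y⟩))))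

  D-coefficient : ∀ a b → D a b Λ.≈ X (CC (suc a) (suc b))
  D-coefficient a b = Λ.trans (Λ.trans (coefficient (λ i → sum {N} (term i)))
      (Λ-Sums.sum-cong-≋ {N} λ i → Λ.trans (coefficient (term i)) (Λ-Sums.sum-cong-≋ {N} (term≈ i))))
    (Λ.sym (Colorings.X-CC≈ N a b))
    where
    term : Fin N → Fin N → Λ⟦x,y⟧
    term i j = indicator (not (toℕ i ≡ᵇ toℕ j)) * ((Xᵢ i * p i j ⟨x⟩) * (Xᵢ j * p j i ⟨y⟩))

    coefficient : ∀ (s : Fin N → Λ⟦x,y⟧) → sum {N} s a b Λ.≈ Λ-Sums.sum {N} (λ i → s i a b)
    coefficient s = Λ.reflexive (≡.trans (≡.cong (λ f → f b) (sum-coefficient {N} s a))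
      (Z-Sums.sum-coefficient {N} (λ i → s i a) b))

    products : ∀ i j → (Xᵢ i * p i j ⟨x⟩) * (Xᵢ j * p j i ⟨y⟩)
      ≈ (Z.constant (r i) Z.*ˢ p i j) ⟨x⟩ * (Z.constant (r j) Z.*ˢ p j i) ⟨y⟩
    products i j = *-cong
      (trans (*-congʳ {p i j ⟨x⟩} (sym (constant⟨x⟩≈constant⟨y⟩ (r i))))
             (sym (IsRingHomomorphism.*-homo ⟨x⟩-isRingHomomorphism (Z.constant (r i)) (p i j))))
      (sym (IsRingHomomorphism.*-homo constant-isRingHomomorphism (Z.constant (r j)) (p j i)))

    term≈ : ∀ i j → term i j a b Λ.≈ Λ-Sums.indicator (not (toℕ i ≡ᵇ toℕ j))
      Λ.* ((r i Λ.* p i j a) Λ.* (r j Λ.* p j i b))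
    term≈ i j = Λ.trans (indicator-coefficient c ((Xᵢ i * p i j ⟨x⟩) * (Xᵢ j * p j i ⟨y⟩)) a b)
      (Λ.trans (Z-Sums.indicator-coefficient c (((Xᵢ i * p i j ⟨x⟩) * (Xᵢ j * p j i ⟨y⟩)) a) b)
      (Λ.*-congˡ {Λ-Sums.indicator c} (Λ.trans (products i j a b)
        (Λ.trans (⟨x⟩*⟨y⟩-coefficient (Z.constant (r i) Z.*ˢ p i j) (Z.constant (r j) Z.*ˢ p j i) a b)
          (Λ.*-cong (Z.constant-* (r i) (p i j) a) (Z.constant-* (r j) (p j i) b))))))
      where c = not (toℕ i ≡ᵇ toℕ j)

  -- The indices in `D` count the interior vertices of the two arcs, one less than their edges; the
  -- factor x y makes up for the difference and for the vanishing terms with index 0.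
  ∑X-CC≈ : ∑X-CC ≈ x * y * D
  ∑X-CC≈ a b = Λ.trans (shifted a b) (sym (*-assoc x y D) a b)
    where
    shifted : ∀ a b → ∑X-CC a b Λ.≈ (x * (y * D)) a b
    shifted zero    b       = Λ.sym (indeterminate-*₀ (y * D) b)
    shifted (suc a) zero    = Λ.sym (Λ.trans (indeterminate-* (y * D) a 0)
      (Λ.trans (constant-* Z.indeterminate D a 0) (Z.indeterminate-*₀ (D a))))
    shifted (suc a) (suc b) = Λ.sym (Λ.trans (indeterminate-* (y * D) a (suc b))
      (Λ.trans (constant-* Z.indeterminate D a (suc b)) (Λ.trans (Z.indeterminate-* (D a) b) (D-coefficient a b))))

  module x-Image = Image Z.seriesRing seriesRing ⟨x⟩-isRingHomomorphism
  module y-Image = Image Z.seriesRing seriesRing constant-isRingHomomorphism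
  module x-Generators = x-Image.Generators Z.indeterminate (Z.constant ∘ r) x Xᵢ z⟨x⟩≈x (λ i → constant⟨x⟩≈constant⟨y⟩ (r i))
  module y-Generators = y-Image.Generators Z.indeterminate (Z.constant ∘ r) y Xᵢ refl (λ i → refl)

  open CycleChordIdentity.Identity seriesRing x y
      (E ⟨x⟩) (E ′ ⟨x⟩) (E ′ ′ ⟨x⟩) (F ⟨x⟩) (F ⁻¹ ⟨x⟩)
      (E ⟨y⟩) (E ′ ⟨y⟩) (E ′ ′ ⟨y⟩) (F ⟨y⟩) (F ⁻¹ ⟨y⟩)
      Xᵢ (λ i → d i ⟨x⟩) (λ i → d i ⟨y⟩)
      (λ i → x-Generators.inverse-image (d i) i (d-inverse i))
      (λ i → y-Generators.inverse-image (d i) i (d-inverse i))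
      (x-Generators.*-s-image d E (E ′) E′≈)
      (y-Generators.*-s-image d E (E ′) E′≈)
      (x-Generators.*-s²-s₂-image d E (E ′ ′) E″≈)
      (y-Generators.*-s²-s₂-image d E (E ′ ′) E″≈)
      (x-Generators.-z*-image E (E ′) F (CommutativeRing.refl Z.seriesRing))
      (y-Generators.-z*-image E (E ′) F (CommutativeRing.refl Z.seriesRing))
      (x-Image.*-1-image F (F ⁻¹) F*F⁻¹≈1)
      (y-Image.*-1-image F (F ⁻¹) F*F⁻¹≈1)
      (λ i j → p i j ⟨x⟩) (λ i j → p i j ⟨y⟩)
      (λ i j i≢j → x-Image.quotient-image (p i j) F (F ⁻¹) E (d i) (d j) F*F⁻¹≈1 (p*F≈ i j i≢j))
      (λ i j i≢j → y-Image.quotient-image (p i j) F (F ⁻¹) E (d i) (d j) F*F⁻¹≈1 (p*F≈ i j i≢j))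
      using (identity) public

open Defs using (_′; _⁻¹; _+_; _*_; _-_; _≈_; _^_; _·_)

theorem4p1 : (x - y) ^ 3 * ∑X-CC
    ≈ x * y *
    ( (x - y) * ( (x ^ 2 * E ′ ′ ⟨x⟩ * E ⟨y⟩ + y ^ 2 * E ′ ′ ⟨y⟩ * E ⟨x⟩)
    * (F ⁻¹ ⟨x⟩ * F ⁻¹ ⟨y⟩) )
    - 2 · (x * y) * (E ′ ⟨x⟩ * F ⁻¹ ⟨x⟩ - E ′ ⟨y⟩ * F ⁻¹ ⟨y⟩) )
-- The ring is chosen after the monomial: as many colors as α has exponents.
theorem4p1 a b α = trans (*-congˡ {(x - y) ^ 3} ∑X-CC≈) identity a b α ≡.refl
  where
  open TwoVariables (length α)
  open CommutativeRing seriesRing using (trans; *-congˡ)
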